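{- For $n\ge 1$ and $0\le p\le n-1$, let $G_{n,p}$ be the number of configurations of size $n$ in which exactly $p$ of the other $n-1$ pairs contain the given pair. Then $$\sum_{n\ge1}\sum_{p=0}^{n-1} G_{n,p}\,y^p\,\frac{z^n}{n!}=\frac{1}{(1-y)\sqrt{1-2z}}\ln\left(\frac{1-z(1+y)}{1-2z}\right).$$
   Context: Fix $n\ge1$. A configuration (of size $n$) is a perfect matching of the $2n$ points $1,2,\dots,2n$ (laid out on a line) into $n$ unordered pairs, together with one distinguished pair, called the given pair; the other $n-1$ pairs are treated as indistinguishable, so there are $n\,(2n-1)!!$ configurations. Let the given pair be $\{g<h\}$ and let $\{a<b\}$ be another pair. The pair $\{a,b\}$ contains the given pair if $a<g<h<b$. -}

module Defs where

open import Data.Nat as ℕ using (ℕ; zero; suc; _∸_; _!; _≡ᵇ_; _<ᵇ_)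
open import Data.Nat.Properties using (_!≢0)
open import Data.Integer as ℤ using (ℤ; +_; -[1+_])
open import Data.Rational as ℚ using (ℚ; 0ℚ; 1ℚ; _+_; _*_; _-_; -_; _/_)
open import Data.Fin as Fin using (Fin; toℕ)
open import Data.Vec as Vec using (Vec; []; _∷_; lookup)
open import Data.List as List using (List; []; _∷_; length; filter; map; concatMap; allFin)
open import Data.Bool using (Bool; true; false; if_then_else_; _∧_; not)
open import Data.Product using (_×_; _,_)
open import Relation.Nullary.Decidable using (Dec)
open import Data.Bool using (T)
open import Data.Bool.Properties using (T?)

-- Configurations.  Points are 0,…,2n-1 (the paper's 1,…,2n shifted by 1;
-- only the order matters).  A perfect matching of Fin m is represented by
-- its partner map, tabulated as a vector v : Vec (Fin m) m, which must be a
-- fixed-point-free involution.  A configuration is a pair (v , g) where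
-- g is the smaller endpoint of the given pair (so the given pair is
-- {g < v[g]}).  There are n·(2n-1)!! configurations.

allVecs : (m k : ℕ) → List (Vec (Fin m) k)
allVecs m zero    = [] ∷ []
allVecs m (suc k) = concatMap (λ x → map (x ∷_) (allVecs m k)) (allFin m)

ltF : ∀ {m} → Fin m → Fin m → Bool
ltF a b = toℕ a <ᵇ toℕ b

eqF : ∀ {m} → Fin m → Fin m → Bool
eqF a b = toℕ a ≡ᵇ toℕ b

allB : ∀ {m} → (Fin m → Bool) → Bool
allB {m} P = List.foldr (λ x r → P x ∧ r) true (allFin m)

isMatching : ∀ {m} → Vec (Fin m) m → Bool
isMatching v = allB (λ x → not (eqF (lookup v x) x) ∧ eqF (lookup v (lookup v x)) x)

nContaining : ∀ {m} → Vec (Fin m) m → Fin m → ℕ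
nContaining {m} v g =
  length (filter (λ a → T? (ltF a (lookup v a) ∧ ltF a g ∧ ltF (lookup v g) (lookup v a)))
                 (allFin m))

Configs : (n : ℕ) → List (Vec (Fin (2 ℕ.* n)) (2 ℕ.* n) × Fin (2 ℕ.* n))
Configs n =
  concatMap (λ v → map (v ,_) (filter (λ g → T? (ltF g (lookup v g))) (allFin (2 ℕ.* n))))
            (filter (λ v → T? (isMatching v)) (allVecs (2 ℕ.* n) (2 ℕ.* n)))

G : ℕ → ℕ → ℕ
G n p = length (filter (λ c → T? (nContaining (Data.Product.proj₁ c) (Data.Product.proj₂ c) ≡ᵇ p))
                       (Configs n))

-- Formal power series in two variables y, z over ℚ:
-- F i n = coefficient of y^i z^n.

FPS : Set
FPS = ℕ → ℕ → ℚ

sumTo : ℕ → (ℕ → ℚ) → ℚ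
sumTo zero    f = f 0
sumTo (suc N) f = sumTo N f + f (suc N)

δ : ℕ → ℕ → ℚ
δ a b = if a ≡ᵇ b then 1ℚ else 0ℚ

constS : ℚ → FPS
constS c i n = c * (δ i 0 * δ n 0)

yS : FPS
yS i n = δ i 1 * δ n 0

zS : FPS
zS i n = δ i 0 * δ n 1

_⊕_ : FPS → FPS → FPS
(F ⊕ H) i n = F i n + H i n

_⊖_ : FPS → FPS → FPS
(F ⊖ H) i n = F i n - H i n

scale : ℚ → FPS → FPS
scale c F i n = c * F i n

_⊛_ : FPS → FPS → FPS
(F ⊛ H) i n = sumTo i (λ a → sumTo n (λ b → F a b * H (i ∸ a) (n ∸ b)))

powS : FPS → ℕ → FPS
powS F zero    = constS 1ℚ
powS F (suc k) = F ⊛ powS F k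

-- composition f(w) = Σ_k f_k w^k of a univariate series f (coefficients
-- f k) with a bivariate series w having zero constant term; then w^k only
-- contributes to total degree ≥ k, so the coefficient of y^i z^n is the
-- finite sum over k ≤ i + n.
compose : (ℕ → ℚ) → FPS → FPS
compose f w i n = sumTo (i ℕ.+ n) (λ k → f k * powS w k i n)

geomC : ℕ → ℚ
geomC _ = 1ℚ

log1pC : ℕ → ℚ
log1pC zero    = 0ℚ
log1pC (suc k) = sgn k * (+ 1 / suc k)
  where
  sgn : ℕ → ℚ
  sgn zero    = 1ℚ
  sgn (suc j) = - sgn j

fallingQ : ℚ → ℕ → ℚ
fallingQ α zero    = 1ℚ
fallingQ α (suc k) = fallingQ α k * (α - (+ k / 1))

binomC : ℚ → ℕ → ℚ
binomC α k = fallingQ α k * (+ 1 / (k !)) {{k !≢0}}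

lhsS : FPS
lhsS p n = if (0 <ᵇ n) ∧ (p <ᵇ n) then (+ G n p / (n !)) {{n !≢0}} else 0ℚ

-- 1/(1-y) · (1-2z)^(-1/2) · ln( (1 - z(1+y)) / (1-2z) )
-- where the quotient is (1 - z(1+y)) · 1/(1-2z) and ln X = ln(1 + (X - 1)).
rhsS : FPS
rhsS = compose geomC yS
     ⊛ (compose (binomC (-[1+ 0 ] / 2)) (scale (-[1+ 1 ] / 1) zS)
     ⊛ compose log1pC
         (((constS 1ℚ ⊖ (zS ⊛ (constS 1ℚ ⊕ yS))) ⊛ compose geomC (scale (+ 2 / 1) zS))
           ⊖ constS 1ℚ))

-- Let the given pair {g,h} leave x points to its left, w inside and r to its right, and let
-- M count the matchings of these points by the number of left-right pairs. Deleting the pair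
-- of an inner point shows that the sum Total n of M over x + w + r = 2 n satisfies
--   Total (n+1) = (2n+3) Total n + Adjacent (n+1),
-- where Adjacent is the part w = 0. Deleting the pair of a left point there, and using the
-- left-right symmetry of M to replace x + 1 by its average n + 1, gives
--   Adjacent (n+1) = (n+1) (1+y) Adjacent n + (2n+1)!!.
-- Put θ = z d/dz and B = (1-2z)^(-1/2). The right-hand side P of the theorem satisfies
--   (1-2z) θP = zP + C,  (1 - z(1+y)) C = zB,  (1-2z) θB = zB,
-- which are the same recurrences for the coefficients of zⁿ multiplied by n! (P, B) or
-- by (n-1)! (C).
module Submission where

open import Defs
open import Relation.Binary.PropositionalEquality using (_≡_)
open import Data.Nat using (ℕ)

-- No recurrence is solved: the closed form enters only through three first-order equations, and
-- coefficients are compared by induction on n. An inner point is deleted whenever there is one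
-- because its pair never contains the given pair, so the factor 2n+3 depends on the size alone.
-- When w = 0 a left point has x - 1 left partners without a factor y and r right partners with one.
-- These weights vary with the position of the given pair, hence the averaging. The definition of
-- `M` prefers one side to the other, so its symmetry is hidden; it is recovered by deleting a left
-- and a right point in both orders. For the closed form, the argument of the logarithm is 1 + W
-- with W = z(1-y)/(1-2z). This gives (1 - z(1+y)) (1-2z) θ ln(1+W) = z(1-y), whose factor 1-y
-- cancels the prefactor 1/(1-y). So C = B (1-2z) θ ln(1+W) / (1-y) has the simple equation stated
-- for it.

module Recurrence where
  open import Data.Nat using (zero; suc; _+_; _*_; pred; _<_; s≤s)
  open import Data.Nat.Properties
  open import Data.Bool using (Bool; true; false)
  open import Data.Nat.Solver using (module +-*-Solver)
  open import Relation.Binary.PropositionalEquality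
  open +-*-Solver using (solve; _:+_; _:*_; _:=_; con)

  -- Matchings counted by the sides of the given pair, and their symmetry

  data Side : Set where
    left inner right : Side

  across : Side → Side → Bool
  across left  right = true
  across right left  = true
  across _     _     = false

  -- Multiplication by y (for `true`) or by 1 of a polynomial in y given by its coefficients.
  shift : Bool → (ℕ → ℕ) → ℕ → ℕ
  shift false f p       = f p
  shift true  f zero    = 0
  shift true  f (suc p) = f p

  -- One point on side s has been taken away, leaving (x , w , r); its partner is among these.
  removal : Side → (ℕ → ℕ → ℕ → ℕ → ℕ) → ℕ → ℕ → ℕ → ℕ → ℕ
  removal s f x w r p =
      x * shift (across s left)  (f (pred x) w r) p
    + w * shift (across s inner) (f x (pred w) r) p
    + r * shift (across s right) (f x w (pred r)) p

  -- M k x w r p: the number of matchings into k pairs of x points left of g, w points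
  -- between g and h, and r points right of h, in which p pairs contain {g,h}.
  M : ℕ → ℕ → ℕ → ℕ → ℕ → ℕ
  M zero    zero    zero    zero    zero = 1
  M zero    _       _       _       _    = 0
  M (suc k) x       (suc w) r       p    = removal inner (M k) x w r p
  M (suc k) (suc x) zero    r       p    = removal left (M k) x zero r p
  M (suc k) zero    zero    (suc r) p    = removal right (M k) zero zero r p
  M (suc k) zero    zero    zero    p    = 0

  shift-cong : ∀ b {f g : ℕ → ℕ} → (∀ p → f p ≡ g p) → ∀ p → shift b f p ≡ shift b g p
  shift-cong false e p       = e p
  shift-cong true  e zero    = refl
  shift-cong true  e (suc p) = e p

  M-0-right : ∀ x w r p → M 0 x w (suc r) p ≡ 0
  M-0-right zero    zero    r p = refl
  M-0-right zero    (suc w) r p = refl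
  M-0-right (suc x) w       r p = refl

  -- `M` deletes a left point in preference to a right one; without inner points the preference does
  -- not matter. If one left and one right point are deleted in either order, they are partners of
  -- each other, or their two pairs are deleted independently. The many small cases arise because
  -- `shift` and `pred` reduce only on constructors.
  removal-right : ∀ k x r p → M (suc k) x 0 (suc r) p ≡ removal right (M k) x 0 r p
  removal-right k       zero       r          p       = refl
  removal-right zero    (suc x)    r          zero    rewrite M-0-right (pred x) 0 r 0 | *-zeroʳ x | *-zeroʳ r = refl
  removal-right zero    (suc zero)    zero    (suc p) =
    solve 1 (λ a → con 0 :+ con 0 :+ con 1 :* a := con 1 :* a :+ con 0 :+ con 0) refl (M 0 0 0 0 p)
  removal-right zero    (suc zero)    (suc r) (suc p) rewrite *-zeroʳ r = refl
  removal-right zero    (suc (suc x)) r       (suc p) rewrite *-zeroʳ r | M-0-right x 0 r (suc p) | *-zeroʳ x = refl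
  removal-right (suc k) (suc zero) zero       zero    = refl
  removal-right (suc k) (suc zero) (suc r)    zero    rewrite *-zeroʳ r | *-zeroʳ r = refl
  removal-right (suc k) (suc (suc x)) zero    zero    rewrite removal-right k x 0 0 | *-zeroʳ x | *-zeroʳ x = refl
  removal-right (suc k) (suc (suc x)) (suc r) zero    rewrite removal-right k x (suc r) 0 =
    solve 3 (λ x r m → (con 1 :+ x) :* (x :* con 0 :+ con 0 :+ (con 1 :+ r) :* m) :+ con 0 :+ (con 2 :+ r) :* con 0
       := (con 2 :+ x) :* con 0 :+ con 0 :+ (con 1 :+ r) :* ((con 1 :+ x) :* m :+ con 0 :+ r :* con 0)) refl x r (M k x 0 r 0)
  removal-right (suc k) (suc zero) zero       (suc p) = refl
  removal-right (suc k) (suc zero) (suc r)    (suc p) =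
    solve 2 (λ r m → (con 2 :+ r) :* (r :* m) := con 1 :* (r :* m) :+ con 0 :+ (con 1 :+ r) :* (r :* m)) refl r (M k 0 0 (pred r) p)
  removal-right (suc k) (suc (suc x)) zero    (suc p) rewrite removal-right k x 0 (suc p) =
    solve 2 (λ x m → (con 1 :+ x) :* (x :* m :+ con 0 :+ con 0) :+ con 0 :+ (con 1 :* (x :* m :+ con 0 :+ con 0))
        := (con 2 :+ x) :* (x :* m :+ con 0 :+ con 0) :+ con 0 :+ con 0) refl x (M k (pred x) 0 0 p)
  removal-right (suc k) (suc (suc x)) (suc r) (suc p) = begin
      suc x * M (suc k) x 0 (2 + r) (suc p) + 0 + (2 + r) * m₀
    ≡⟨ cong (λ t → suc x * t + 0 + (2 + r) * m₀) (removal-right k x (suc r) (suc p)) ⟩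
      suc x * (x * a + 0 + suc r * b) + 0 + (2 + r) * m₀
    -- `m₀` counts what remains when the deleted left point has a right partner. One of its 2 + r
    -- copies is set aside for the case that this partner is the deleted right point. The other
    -- copies are expanded by a right deletion, and the terms regroup into left deletions.
    ≡⟨ solve 5 (λ x r a b m → (con 1 :+ x) :* (x :* a :+ con 0 :+ (con 1 :+ r) :* b) :+ con 0 :+ (con 2 :+ r) :* m
          := (con 1 :+ x) :* (x :* a) :+ (con 1 :+ r) :* m :+ (m :+ (con 1 :+ x) :* ((con 1 :+ r) :* b))) refl x r a b m₀ ⟩
      suc x * (x * a) + suc r * m₀ + (m₀ + suc x * (suc r * b))
    ≡⟨ cong (λ t → suc x * (x * a) + suc r * t + (m₀ + suc x * (suc r * b))) (removal-right k (suc x) r p) ⟩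
      suc x * (x * a) + suc r * (suc x * d + 0 + r * c) + (m₀ + suc x * (suc r * b))
    ≡⟨ solve 7 (λ x r a b m c d → (con 1 :+ x) :* (x :* a) :+ (con 1 :+ r) :* ((con 1 :+ x) :* d :+ con 0 :+ r :* c) :+ (m :+ (con 1 :+ x) :* ((con 1 :+ r) :* b))
          := (con 1 :+ x) :* (x :* a :+ con 0 :+ (con 1 :+ r) :* d) :+ (con 1 :+ r) :* (r :* c) :+ (m :+ (con 1 :+ x) :* ((con 1 :+ r) :* b))) refl x r a b m₀ c d ⟩
      suc x * m₀ + suc r * (r * c) + (m₀ + suc x * (suc r * b))
    ≡⟨ solve 5 (λ x r b c m → (con 1 :+ x) :* m :+ (con 1 :+ r) :* (r :* c) :+ (m :+ (con 1 :+ x) :* ((con 1 :+ r) :* b))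
          := (con 2 :+ x) :* m :+ con 0 :+ (con 1 :+ r) :* ((con 1 :+ x) :* b :+ con 0 :+ r :* c)) refl x r b c m₀ ⟩
      (2 + x) * m₀ + 0 + suc r * (suc x * b + 0 + r * c) ∎
    where
    open ≡-Reasoning
    m₀ = M (suc k) (suc x) 0 (suc r) p
    a = M k (pred x) 0 (suc r) p
    b = M k x 0 r (suc p)
    c = M k (suc x) 0 (pred r) p
    d = shift true (M k x 0 r) p

  -- Reflection turns a left deletion into a right one, which `removal-right` permits on the
  -- reflected side.
  M-sym : ∀ k x r p → M k x 0 r p ≡ M k r 0 x p
  M-sym zero    zero    zero    p = refl
  M-sym zero    zero    (suc r) p = refl
  M-sym zero    (suc x) zero    p = refl
  M-sym zero    (suc x) (suc r) p = refl
  M-sym (suc k) zero    zero    p = refl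
  M-sym (suc k) (suc x) r       p = begin
      removal left (M k) x 0 r p
    ≡⟨ cong₂ (λ a b → x * a + 0 + r * b) (M-sym k (pred x) r p) (shift-cong true (M-sym k x (pred r)) p) ⟩
      x * M k r 0 (pred x) p + 0 + r * shift true (M k (pred r) 0 x) p
    ≡⟨ solve 2 (λ a b → a :+ con 0 :+ b := b :+ con 0 :+ a) refl (x * M k r 0 (pred x) p) _ ⟩
      removal right (M k) r 0 x p
    ≡⟨ sym (removal-right k r x p) ⟩
      M (suc k) r 0 (suc x) p ∎
    where open ≡-Reasoning
  M-sym (suc k) zero    (suc r) p = begin
      removal right (M k) 0 0 r p
    ≡⟨ cong (r *_) (M-sym k 0 (pred r) p) ⟩
      r * M k (pred r) 0 0 p
    ≡⟨ solve 1 (λ a → a := a :+ con 0 :+ con 0) refl (r * M k (pred r) 0 0 p) ⟩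
      removal left (M k) r 0 0 p ∎
    where open ≡-Reasoning

  -- Sums over gap sizes, and the recurrences for `Total` and `Adjacent`

  Σ₂ : ℕ → (ℕ → ℕ → ℕ) → ℕ
  Σ₂ zero    f = f 0 0
  Σ₂ (suc N) f = f 0 (suc N) + Σ₂ N (λ a b → f (suc a) b)

  Σ₃ : ℕ → (ℕ → ℕ → ℕ → ℕ) → ℕ
  Σ₃ zero    f = f 0 0 0
  Σ₃ (suc N) f = Σ₂ (suc N) (f 0) + Σ₃ N (λ a → f (suc a))

  Σ₂-cong : ∀ N {f g} → (∀ a b → a + b ≡ N → f a b ≡ g a b) → Σ₂ N f ≡ Σ₂ N g
  Σ₂-cong zero    e = e 0 0 refl
  Σ₂-cong (suc N) e = cong₂ _+_ (e 0 (suc N) refl) (Σ₂-cong N (λ a b q → e (suc a) b (cong suc q)))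

  Σ₂-+ : ∀ N f g → Σ₂ N (λ a b → f a b + g a b) ≡ Σ₂ N f + Σ₂ N g
  Σ₂-+ zero    f g = refl
  Σ₂-+ (suc N) f g rewrite Σ₂-+ N (λ a b → f (suc a) b) (λ a b → g (suc a) b) =
    solve 4 (λ a b c d → a :+ b :+ (c :+ d) := a :+ c :+ (b :+ d)) refl (f 0 (suc N)) (g 0 (suc N)) _ _

  Σ₂-* : ∀ N c f → Σ₂ N (λ a b → c * f a b) ≡ c * Σ₂ N f
  Σ₂-* zero    c f = refl
  Σ₂-* (suc N) c f rewrite Σ₂-* N c (λ a b → f (suc a) b) = sym (*-distribˡ-+ c (f 0 (suc N)) _)

  Σ₂-last : ∀ N f → Σ₂ (suc N) f ≡ f (suc N) 0 + Σ₂ N (λ a b → f a (suc b))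
  Σ₂-last zero    f = +-comm (f 0 1) (f 1 0)
  Σ₂-last (suc N) f rewrite Σ₂-last N (λ a b → f (suc a) b) =
    solve 3 (λ a b c → a :+ (b :+ c) := b :+ (a :+ c)) refl (f 0 (2 + N)) (f (2 + N) 0) _

  Σ₂-swap : ∀ N f → Σ₂ N f ≡ Σ₂ N (λ a b → f b a)
  Σ₂-swap zero    f = refl
  Σ₂-swap (suc N) f = trans (cong (f 0 (suc N) +_) (Σ₂-swap N (λ a b → f (suc a) b))) (sym (Σ₂-last N (λ a b → f b a)))

  Σ₃-cong : ∀ N {f g} → (∀ a b c → a + b + c ≡ N → f a b c ≡ g a b c) → Σ₃ N f ≡ Σ₃ N g
  Σ₃-cong zero    e = e 0 0 0 refl
  Σ₃-cong (suc N) e = cong₂ _+_ (Σ₂-cong (suc N) (λ a b q → e 0 a b q))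
                                (Σ₃-cong N (λ a b c q → e (suc a) b c (cong suc q)))

  Σ₃-+ : ∀ N f g → Σ₃ N (λ a b c → f a b c + g a b c) ≡ Σ₃ N f + Σ₃ N g
  Σ₃-+ zero    f g = refl
  Σ₃-+ (suc N) f g rewrite Σ₃-+ N (λ a → f (suc a)) (λ a → g (suc a)) | Σ₂-+ (suc N) (f 0) (g 0) =
    solve 4 (λ a b c d → a :+ b :+ (c :+ d) := a :+ c :+ (b :+ d)) refl (Σ₂ (suc N) (f 0)) (Σ₂ (suc N) (g 0)) _ _

  Σ₃-* : ∀ N k f → Σ₃ N (λ a b c → k * f a b c) ≡ k * Σ₃ N f
  Σ₃-* zero    k f = refl
  Σ₃-* (suc N) k f rewrite Σ₃-* N k (λ a → f (suc a)) | Σ₂-* (suc N) k (f 0) =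
    sym (*-distribˡ-+ k (Σ₂ (suc N) (f 0)) _)

  Σ₃-inner : ∀ N f → Σ₃ (suc N) f ≡ Σ₂ (suc N) (λ a c → f a 0 c) + Σ₃ N (λ a b → f a (suc b))
  Σ₃-inner zero    f = solve 3 (λ a b c → a :+ b :+ c := a :+ c :+ b) refl (f 0 0 1) (f 0 1 0) (f 1 0 0)
  Σ₃-inner (suc N) f rewrite Σ₃-inner N (λ a → f (suc a)) =
    solve 4 (λ a b c d → a :+ b :+ (c :+ d) := a :+ c :+ (b :+ d)) refl (f 0 0 (2 + N)) (Σ₂ (suc N) (λ b → f 0 (suc b))) _ _

  Σ₃-last : ∀ N f → Σ₃ (suc N) f ≡ Σ₂ (suc N) (λ a b → f a b 0) + Σ₃ N (λ a b c → f a b (suc c))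
  Σ₃-last zero    f = solve 3 (λ a b c → a :+ b :+ c := b :+ c :+ a) refl (f 0 0 1) (f 0 1 0) (f 1 0 0)
  Σ₃-last (suc N) f rewrite Σ₃-last N (λ a → f (suc a)) | Σ₂-last (suc N) (f 0) =
    solve 4 (λ a b c d → a :+ b :+ (c :+ d) := a :+ c :+ (b :+ d)) refl (f 0 (2 + N) 0) (Σ₂ (suc N) (λ b c → f 0 b (suc c))) _ _

  Σ₂-0 : ∀ N → Σ₂ N (λ _ _ → 0) ≡ 0
  Σ₂-0 zero    = refl
  Σ₂-0 (suc N) = Σ₂-0 N

  -- Exposes two successors at each step, so that sums up to `double (suc n)` unfold by computation;
  -- `2 * suc n` exposes only one.
  double : ℕ → ℕ
  double zero    = zero
  double (suc n) = suc (suc (double n))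

  -- The given pair is not among the n pairs counted here, so `Total n` belongs to size n + 1. In
  -- `Adjacent` the ends of the given pair are neighbours.
  Total Adjacent : ℕ → ℕ → ℕ
  Total n p = Σ₃ (double n) (λ x w r → M n x w r p)
  Adjacent n p = Σ₂ (double n) (λ x r → M n x 0 r p)

  Total-suc : ∀ n p → Total (suc n) p ≡ (3 + double n) * Total n p + Adjacent (suc n) p
  Total-suc n p = begin
      Total (suc n) p
    ≡⟨ Σ₃-inner (suc D) (λ x w r → M (suc n) x w r p) ⟩
      Adjacent (suc n) p + Σ₃ (suc D) (λ x w r → x * M n (pred x) w r p + w * M n x (pred w) r p + r * M n x w (pred r) p)
    ≡⟨ cong (Adjacent (suc n) p +_) (trans (Σ₃-+ (suc D) (λ x w r → x * M n (pred x) w r p + w * M n x (pred w) r p) (λ x w r → r * M n x w (pred r) p))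
         (cong₂ _+_ (Σ₃-+ (suc D) (λ x w r → x * M n (pred x) w r p) (λ x w r → w * M n x (pred w) r p)) refl)) ⟩
      Adjacent (suc n) p + (Σ₃ (suc D) (λ x w r → x * M n (pred x) w r p)
         + Σ₃ (suc D) (λ x w r → w * M n x (pred w) r p)
         + Σ₃ (suc D) (λ x w r → r * M n x w (pred r) p))
    -- Each factor x, w, r kills the layer where it is 0. Lowering that variable by one leaves sums
    -- over x + w + r = 2 n with weights x + 1, w + 1, r + 1, and these add up to the constant 2 n +
    -- 3.
    ≡⟨ cong (Adjacent (suc n) p +_) (cong₂ _+_ (cong₂ _+_
         (cong₂ _+_ (Σ₂-0 (suc D)) refl)
         (trans (Σ₃-inner D (λ x w r → w * M n x (pred w) r p)) (cong₂ _+_ (Σ₂-0 (suc D)) refl)))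
         (trans (Σ₃-last D (λ x w r → r * M n x w (pred r) p)) (cong₂ _+_ (Σ₂-0 (suc D)) refl))) ⟩
      Adjacent (suc n) p + (Σ₃ D (λ x w r → suc x * m x w r) + Σ₃ D (λ x w r → suc w * m x w r) + Σ₃ D (λ x w r → suc r * m x w r))
    ≡⟨ cong (Adjacent (suc n) p +_) (sym (trans (Σ₃-+ D _ (λ x w r → suc r * m x w r))
         (cong₂ _+_ (Σ₃-+ D (λ x w r → suc x * m x w r) (λ x w r → suc w * m x w r)) refl))) ⟩
      Adjacent (suc n) p + Σ₃ D (λ x w r → suc x * m x w r + suc w * m x w r + suc r * m x w r)
    ≡⟨ cong (Adjacent (suc n) p +_) (Σ₃-cong D λ x w r q → trans
         (solve 4 (λ x w r m → (con 1 :+ x) :* m :+ (con 1 :+ w) :* m :+ (con 1 :+ r) :* m := (con 3 :+ (x :+ w :+ r)) :* m) refl x w r (m x w r))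
         (cong (λ t → (3 + t) * m x w r) q)) ⟩
      Adjacent (suc n) p + Σ₃ D (λ x w r → (3 + D) * m x w r)
    ≡⟨ cong (Adjacent (suc n) p +_) (Σ₃-* D (3 + D) m) ⟩
      Adjacent (suc n) p + (3 + D) * Total n p
    ≡⟨ +-comm (Adjacent (suc n) p) _ ⟩
      (3 + D) * Total n p + Adjacent (suc n) p ∎
    where
    open ≡-Reasoning
    D = double n
    m : ℕ → ℕ → ℕ → ℕ
    m x w r = M n x w r p

  shift-Σ₂ : ∀ N (f : ℕ → ℕ → ℕ → ℕ) p →
             Σ₂ N (λ a b → shift true (f a b) p) ≡ shift true (λ q → Σ₂ N (λ a b → f a b q)) p
  shift-Σ₂ N f zero    = Σ₂-0 N
  shift-Σ₂ N f (suc p) = refl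

  double≡+ : ∀ n → double n ≡ n + n
  double≡+ zero    = refl
  double≡+ (suc n) = cong suc (trans (cong suc (double≡+ n)) (sym (+-suc n n)))

  -- By symmetry the average of x over x + r = 2 n, weighted by m, is n.
  Σ₂-average : ∀ n (m : ℕ → ℕ → ℕ) → (∀ x r → m x r ≡ m r x) →
               Σ₂ (double n) (λ x r → suc x * m x r) ≡ suc n * Σ₂ (double n) m
  Σ₂-average n m m-sym = *-cancelˡ-≡ _ _ 2 (begin
      2 * X
    ≡⟨ cong (X +_) (+-identityʳ X) ⟩
      X + X
    ≡⟨ cong (X +_) (trans (Σ₂-swap D _) (Σ₂-cong D (λ x r _ → cong (suc r *_) (m-sym r x)))) ⟩
      X + Σ₂ D (λ x r → suc r * m x r)
    ≡⟨ sym (Σ₂-+ D _ _) ⟩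
      Σ₂ D (λ x r → suc x * m x r + suc r * m x r)
    ≡⟨ Σ₂-cong D (λ x r q → trans (sym (*-distribʳ-+ (m x r) (suc x) (suc r)))
         (cong (_* m x r) (cong suc (trans (+-suc x r) (cong suc (trans q (double≡+ n))))))) ⟩
      Σ₂ D (λ x r → (2 + (n + n)) * m x r)
    ≡⟨ Σ₂-* D (2 + (n + n)) m ⟩
      (2 + (n + n)) * Σ₂ D m
    ≡⟨ solve 2 (λ n s → (con 2 :+ (n :+ n)) :* s := con 2 :* ((con 1 :+ n) :* s)) refl n (Σ₂ D m) ⟩
      2 * (suc n * Σ₂ D m) ∎)
    where
    open ≡-Reasoning
    D = double n
    X = Σ₂ D (λ x r → suc x * m x r)

  -- The layer x = 0 has no left point to delete and survives as the inhomogeneous term, which is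
  -- (2n+1)!! at p = 0 and 0 elsewhere. In the other layers left partners give the factor 1 and
  -- right partners the factor y.
  Adjacent-suc : ∀ n p → Adjacent (suc n) p ≡ suc n * (Adjacent n p + shift true (Adjacent n) p) + M (suc n) 0 0 (2 + double n) p
  Adjacent-suc n p = begin
      M (suc n) 0 0 (2 + D) p + Σ₂ (suc D) (λ x r → x * M n (pred x) 0 r p + 0 + r * shift true (M n x 0 (pred r)) p)
    ≡⟨ +-comm (M (suc n) 0 0 (2 + D) p) _ ⟩
      Σ₂ (suc D) (λ x r → x * M n (pred x) 0 r p + 0 + r * shift true (M n x 0 (pred r)) p) + b
    ≡⟨ cong (_+ b) (trans (Σ₂-+ (suc D) (λ x r → x * M n (pred x) 0 r p + 0) (λ x r → r * shift true (M n x 0 (pred r)) p))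
         (cong₂ _+_ (Σ₂-cong (suc D) {g = λ x r → x * M n (pred x) 0 r p} (λ x r _ → +-identityʳ _)) (Σ₂-last D (λ x r → r * shift true (M n x 0 (pred r)) p)))) ⟩
      Σ₂ D (λ x r → suc x * M n x 0 r p) + Σ₂ D (λ x r → suc r * shift true (M n x 0 r) p) + b
    ≡⟨ cong (_+ b) (cong₂ _+_ (Σ₂-average n (λ x r → M n x 0 r p) (λ x r → M-sym n x r p))
         (trans (Σ₂-swap D _) (trans (Σ₂-average n (λ r x → shift true (M n x 0 r) p) (λ r x → shift-cong true (M-sym n x r) p))
            (cong (suc n *_) (trans (Σ₂-swap D _) (shift-Σ₂ D (λ x r → M n x 0 r) p)))))) ⟩
      suc n * Adjacent n p + suc n * shift true (Adjacent n) p + b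
    ≡⟨ cong (_+ b) (sym (*-distribˡ-+ (suc n) (Adjacent n p) _)) ⟩
      suc n * (Adjacent n p + shift true (Adjacent n) p) + b ∎
    where
    open ≡-Reasoning
    D = double n
    b = M (suc n) 0 0 (2 + D) p

  M-right-suc : ∀ n p → M n 0 0 (double n) (suc p) ≡ 0
  M-right-suc zero    p = refl
  M-right-suc (suc n) p = trans (cong (suc (double n) *_) (M-right-suc n p)) (*-zeroʳ (double n))

  Adjacent-bound : ∀ n p → n < p → Adjacent n p ≡ 0
  Adjacent-bound zero    (suc p) _ = refl
  Adjacent-bound (suc n) (suc p) (s≤s n<p)
    rewrite Adjacent-suc n (suc p) | Adjacent-bound n (suc p) (m≤n⇒m≤1+n n<p) | Adjacent-bound n p n<p
          | M-right-suc (suc n) p | *-zeroʳ n = refl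

  -- Matches the cut-off in `lhsS`: at size n + 1 only n pairs are available to contain the given
  -- one.
  Total-bound : ∀ n p → n < p → Total n p ≡ 0
  Total-bound zero    (suc p) _ = refl
  Total-bound (suc n) p n<p
    rewrite Total-suc n p | Total-bound n p (<-trans (n<1+n n) n<p) | Adjacent-bound (suc n) p n<p | *-zeroʳ (double n) = refl

-- From the list of configurations to `Total`

module Enumeration where
  open Recurrence
  open import Data.Nat using (zero; suc; _+_; _*_; _∸_; pred; _<_; _≡ᵇ_)
  open import Data.Nat.Properties hiding (_≟_)
  open import Data.Nat.Solver using (module +-*-Solver)
  open import Data.Bool as Bool using (Bool; true; false; if_then_else_; _∧_; not; T)
  open import Data.Bool.Properties using (T?; T-≡)
  open import Data.Fin using (Fin; zero; suc; toℕ)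
  open import Data.Fin.Properties using (_≟_; all?; toℕ-injective; toℕ<n)
  open import Data.Vec using (Vec; []; _∷_; lookup; tabulate)
  open import Data.Vec.Properties using (≡-dec; lookup∘tabulate; tabulate∘lookup; tabulate-cong)
  open import Data.List as List using (List; []; _∷_; _++_; length; filter; map; concatMap; allFin)
  open import Data.List.Properties using (map-tabulate)
  open import Data.List.Relation.Unary.All using (All; []; _∷_)
  import Data.List.Relation.Unary.All.Properties as All
  open import Data.Product using (∃; _×_; _,_; proj₁; proj₂)
  open import Data.Unit using (tt)
  open import Function using (id; _∘_; Equivalence)
  open import Relation.Nullary using (Dec; does; yes; no; ¬_; contradiction)
  open import Relation.Nullary.Decidable using (_×-dec_; dec-true; dec-false)
  open import Relation.Binary.PropositionalEquality
  open +-*-Solver using (solve; _:+_; _:*_; _:=_; con)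

  𝟙 : Bool → ℕ
  𝟙 true  = 1
  𝟙 false = 0

  𝟙-∧ : ∀ a b → 𝟙 (a ∧ b) ≡ 𝟙 a * 𝟙 b
  𝟙-∧ true  b = sym (+-identityʳ (𝟙 b))
  𝟙-∧ false b = refl

  𝟙-*-cong : ∀ b {m n} → (b ≡ true → m ≡ n) → 𝟙 b * m ≡ 𝟙 b * n
  𝟙-*-cong true  e = cong (1 *_) (e refl)
  𝟙-*-cong false e = refl

  does-⇔ : ∀ {a b} {A : Set a} {B : Set b} (x : Dec A) (y : Dec B) → (A → B) → (B → A) → does x ≡ does y
  does-⇔ (yes a) y f g = sym (dec-true y (f a))
  does-⇔ (no ¬a) y f g = sym (dec-false y (¬a ∘ g))

  does⇒ : ∀ {a} {A : Set a} (x : Dec A) → does x ≡ true → A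
  does⇒ (yes a) _ = a

  does⇏ : ∀ {a} {A : Set a} (x : Dec A) → does x ≡ false → ¬ A
  does⇏ (no ¬a) _ = ¬a

  ∑ : ∀ {a} {A : Set a} → List A → (A → ℕ) → ℕ
  ∑ []       f = 0
  ∑ (x ∷ xs) f = f x + ∑ xs f

  module _ {a} {A : Set a} where

    ∑-cong : ∀ (xs : List A) {f g} → (∀ x → f x ≡ g x) → ∑ xs f ≡ ∑ xs g
    ∑-cong []       e = refl
    ∑-cong (x ∷ xs) e = cong₂ _+_ (e x) (∑-cong xs e)

    ∑-0 : ∀ (xs : List A) → ∑ xs (λ _ → 0) ≡ 0
    ∑-0 []       = refl
    ∑-0 (x ∷ xs) = ∑-0 xs

    ∑-+ : ∀ (xs : List A) f g → ∑ xs (λ x → f x + g x) ≡ ∑ xs f + ∑ xs g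
    ∑-+ []       f g = refl
    ∑-+ (x ∷ xs) f g rewrite ∑-+ xs f g =
      solve 4 (λ a b c d → a :+ b :+ (c :+ d) := a :+ c :+ (b :+ d)) refl (f x) (g x) _ _

    ∑-*ˡ : ∀ (xs : List A) c f → ∑ xs (λ x → c * f x) ≡ c * ∑ xs f
    ∑-*ˡ []       c f = sym (*-zeroʳ c)
    ∑-*ˡ (x ∷ xs) c f rewrite ∑-*ˡ xs c f = sym (*-distribˡ-+ c (f x) _)

    ∑-*ʳ : ∀ (xs : List A) c f → ∑ xs (λ x → f x * c) ≡ ∑ xs f * c
    ∑-*ʳ []       c f = refl
    ∑-*ʳ (x ∷ xs) c f rewrite ∑-*ʳ xs c f = sym (*-distribʳ-+ c (f x) _)

    ∑-++ : ∀ (xs ys : List A) f → ∑ (xs ++ ys) f ≡ ∑ xs f + ∑ ys f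
    ∑-++ []       ys f = refl
    ∑-++ (x ∷ xs) ys f rewrite ∑-++ xs ys f = sym (+-assoc (f x) _ _)

    ∑-filter : ∀ (xs : List A) (p : A → Bool) f → ∑ (filter (λ x → T? (p x)) xs) f ≡ ∑ xs (λ x → 𝟙 (p x) * f x)
    ∑-filter []       p f = refl
    ∑-filter (x ∷ xs) p f with p x
    ... | true  = cong₂ _+_ (sym (+-identityʳ (f x))) (∑-filter xs p f)
    ... | false = ∑-filter xs p f

    length≡∑ : ∀ (xs : List A) → length xs ≡ ∑ xs (λ _ → 1)
    length≡∑ []       = refl
    length≡∑ (x ∷ xs) = cong suc (length≡∑ xs)

    length-filter : ∀ (xs : List A) (p : A → Bool) → length (filter (λ x → T? (p x)) xs) ≡ ∑ xs (λ x → 𝟙 (p x))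
    length-filter xs p = trans (length≡∑ (filter (λ x → T? (p x)) xs)) (trans (∑-filter xs p _) (∑-cong xs (λ x → *-identityʳ _)))

    ∑-positive : ∀ (xs : List A) f {n} → ∑ xs f ≡ suc n → ∃ λ x → ∃ λ m → f x ≡ suc m
    ∑-positive (x ∷ xs) f e with f x in eq
    ... | zero  = ∑-positive xs f e
    ... | suc m = x , m , eq

  module _ {a b} {A : Set a} {B : Set b} where

    ∑-comm : ∀ (xs : List A) (ys : List B) (f : A → B → ℕ) →
             ∑ xs (λ x → ∑ ys (f x)) ≡ ∑ ys (λ y → ∑ xs (λ x → f x y))
    ∑-comm []       ys f = sym (∑-0 ys)
    ∑-comm (x ∷ xs) ys f rewrite ∑-comm xs ys f = sym (∑-+ ys (f x) _)

    ∑-map : ∀ (xs : List A) (g : A → B) f → ∑ (map g xs) f ≡ ∑ xs (f ∘ g)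
    ∑-map []       g f = refl
    ∑-map (x ∷ xs) g f = cong (f (g x) +_) (∑-map xs g f)

    ∑-concatMap : ∀ (xs : List A) (g : A → List B) f → ∑ (concatMap g xs) f ≡ ∑ xs (λ x → ∑ (g x) f)
    ∑-concatMap []       g f = refl
    ∑-concatMap (x ∷ xs) g f = trans (∑-++ (g x) _ f) (cong (∑ (g x) f +_) (∑-concatMap xs g f))

  ∑F : ∀ {N} → (Fin N → ℕ) → ℕ
  ∑F {N} = ∑ (allFin N)

  ∑F-suc : ∀ {N} (f : Fin (suc N) → ℕ) → ∑F f ≡ f zero + ∑F (f ∘ suc)
  ∑F-suc {N} f = cong (f zero +_) (trans (cong (λ xs → ∑ xs f) (sym (map-tabulate id suc))) (∑-map (allFin N) suc f))

  -- Every element occurs exactly once, expressed as the sifting property of a delta so that it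
  -- applies directly inside sums.
  Enumerates : ∀ {a} {A : Set a} → (∀ (x y : A) → Dec (x ≡ y)) → List A → Set a
  Enumerates {A = A} _≟_ xs = ∀ (x : A) (f : A → ℕ) → ∑ xs (λ y → 𝟙 (does (y ≟ x)) * f y) ≡ f x

  enumerates-allFin : ∀ N → Enumerates _≟_ (allFin N)
  enumerates-allFin (suc N) zero f = begin
      ∑F (λ y → 𝟙 (does (y ≟ zero)) * f y)
    ≡⟨ ∑F-suc (λ y → 𝟙 (does (y ≟ zero)) * f y) ⟩
      1 * f zero + ∑ (allFin N) (λ _ → 0)
    ≡⟨ cong₂ _+_ (*-identityˡ (f zero)) (∑-0 (allFin N)) ⟩
      f zero + 0
    ≡⟨ +-identityʳ (f zero) ⟩
      f zero ∎
    where open ≡-Reasoning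
  enumerates-allFin (suc N) (suc x) f =
    trans (∑F-suc (λ y → 𝟙 (does (y ≟ suc x)) * f y)) (enumerates-allFin N x (f ∘ suc))

  _≟ⱽ_ : ∀ {m k} (u v : Vec (Fin m) k) → Dec (u ≡ v)
  _≟ⱽ_ = ≡-dec _≟_

  enumerates-allVecs : ∀ m k → Enumerates _≟ⱽ_ (allVecs m k)
  enumerates-allVecs m zero    []      f = trans (+-identityʳ _) (*-identityˡ (f []))
  enumerates-allVecs m (suc k) (y ∷ u) f = begin
      ∑ (allVecs m (suc k)) F
    ≡⟨ ∑-concatMap (allFin m) (λ x → map (x ∷_) (allVecs m k)) F ⟩
      ∑F (λ x → ∑ (map (x ∷_) (allVecs m k)) F)
    ≡⟨ ∑-cong (allFin m) (λ x → trans (∑-map (allVecs m k) (x ∷_) F)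
         (trans (∑-cong (allVecs m k) (λ v → trans (cong (_* f (x ∷ v)) (𝟙-∧ (does (x ≟ y)) (does (v ≟ⱽ u))))
                                              (*-assoc (𝟙 (does (x ≟ y))) _ _)))
                (∑-*ˡ (allVecs m k) (𝟙 (does (x ≟ y))) _))) ⟩
      ∑F (λ x → 𝟙 (does (x ≟ y)) * ∑ (allVecs m k) (λ v → 𝟙 (does (v ≟ⱽ u)) * f (x ∷ v)))
    ≡⟨ enumerates-allFin m y _ ⟩
      ∑ (allVecs m k) (λ v → 𝟙 (does (v ≟ⱽ u)) * f (y ∷ v))
    ≡⟨ enumerates-allVecs m k u _ ⟩
      f (y ∷ u) ∎
    where
    open ≡-Reasoning
    F : Vec (Fin m) (suc k) → ℕ
    F v = 𝟙 (does (v ≟ⱽ (y ∷ u))) * f v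

  module _ {a} {A : Set a} (_≈?_ : ∀ (x y : A) → Dec (x ≡ y)) (xs : List A) (enum : Enumerates _≈?_ xs)
           {p q} {P : A → Set p} {Q : A → Set q} (P? : ∀ x → Dec (P x)) (Q? : ∀ x → Dec (Q x)) where

    -- Both sides equal the double sum over the graph {(v , u) | P v, u = φ v} = {(v , u) | Q u, v = ψ u}.
    ∑-reindex : (φ ψ : A → A) →
                (∀ v → P v → Q (φ v) × ψ (φ v) ≡ v) → (∀ u → Q u → P (ψ u) × φ (ψ u) ≡ u) →
                ∀ (f : A → ℕ) → ∑ xs (λ v → 𝟙 (does (P? v)) * f v) ≡ ∑ xs (λ u → 𝟙 (does (Q? u)) * f (ψ u))
    ∑-reindex φ ψ to from f = begin
        ∑ xs (λ v → 𝟙 (does (P? v)) * f v)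
      ≡⟨ ∑-cong xs (λ v → sym (enum (φ v) _)) ⟩
        ∑ xs (λ v → ∑ xs (λ u → 𝟙 (does (u ≈? φ v)) * (𝟙 (does (P? v)) * f v)))
      ≡⟨ ∑-comm xs xs _ ⟩
        ∑ xs (λ u → ∑ xs (λ v → 𝟙 (does (u ≈? φ v)) * (𝟙 (does (P? v)) * f v)))
      ≡⟨ ∑-cong xs (λ u → ∑-cong xs (λ v → graph u v)) ⟩
        ∑ xs (λ u → ∑ xs (λ v → 𝟙 (does (v ≈? ψ u)) * (𝟙 (does (Q? u)) * f v)))
      ≡⟨ ∑-cong xs (λ u → enum (ψ u) _) ⟩
        ∑ xs (λ u → 𝟙 (does (Q? u)) * f (ψ u)) ∎
      where
      open ≡-Reasoning
      regroup : ∀ x y z → 𝟙 x * (𝟙 y * z) ≡ 𝟙 (x ∧ y) * z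
      regroup x y z = trans (sym (*-assoc (𝟙 x) (𝟙 y) z)) (cong (_* z) (sym (𝟙-∧ x y)))
      graph : ∀ u v → 𝟙 (does (u ≈? φ v)) * (𝟙 (does (P? v)) * f v) ≡ 𝟙 (does (v ≈? ψ u)) * (𝟙 (does (Q? u)) * f v)
      graph u v = trans (regroup (does (u ≈? φ v)) _ _) (trans (cong (λ b → 𝟙 b * f v)
        (does-⇔ ((u ≈? φ v) ×-dec P? v) ((v ≈? ψ u) ×-dec Q? u)
          (λ { (refl , pv) → sym (proj₂ (to v pv)) , proj₁ (to v pv) })
          (λ { (refl , qu) → sym (proj₂ (from u qu)) , proj₁ (from u qu) })))
        (sym (regroup (does (v ≈? ψ u)) _ _)))

  shift-∑ : ∀ {a} {A : Set a} b (xs : List A) (c : A → ℕ) (f : A → ℕ → ℕ) p →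
            ∑ xs (λ x → c x * shift b (f x) p) ≡ shift b (λ q → ∑ xs (λ x → c x * f x q)) p
  shift-∑ false xs c f p       = refl
  shift-∑ true  xs c f zero    = trans (∑-cong xs (λ x → *-zeroʳ (c x))) (∑-0 xs)
  shift-∑ true  xs c f (suc p) = refl

  kronecker : ℕ → ℕ → ℕ
  kronecker a p = 𝟙 (a ≡ᵇ p)

  kronecker-shift : ∀ b a p → kronecker (𝟙 b + a) p ≡ shift b (kronecker a) p
  kronecker-shift false a p       = refl
  kronecker-shift true  a zero    = refl
  kronecker-shift true  a (suc p) = refl

  -- Deleting and restoring a pair of an involution

  lookup-ext : ∀ {a} {A : Set a} {n} {u v : Vec A n} → (∀ x → lookup u x ≡ lookup v x) → u ≡ v
  lookup-ext {u = u} {v} e = trans (sym (tabulate∘lookup u)) (trans (tabulate-cong e) (tabulate∘lookup v))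

  -- A matching of the set of points S; the other points of Fin N are fixed. Removing a pair
  -- turns its ends into fixed points, so that no point is ever renumbered.
  Involution : ∀ {N} → (Fin N → Bool) → Vec (Fin N) N → Set
  Involution S v = ∀ x → lookup v (lookup v x) ≡ x × does (lookup v x ≟ x) ≡ not (S x)

  involution? : ∀ {N} (S : Fin N → Bool) v → Dec (Involution S v)
  involution? S v = all? (λ x → (lookup v (lookup v x) ≟ x) ×-dec (does (lookup v x ≟ x) Bool.≟ not (S x)))

  infixl 6 _−_
  _−_ : ∀ {N} → (Fin N → Bool) → Fin N → Fin N → Bool
  (S − i) x = S x ∧ not (does (x ≟ i))

  module _ {N : ℕ} (i j : Fin N) where

    rewire : Fin N → Fin N → Vec (Fin N) N → Vec (Fin N) N
    rewire a b v = tabulate (λ x → if does (x ≟ i) then a else if does (x ≟ j) then b else lookup v x)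

    rewire-i : ∀ a b v → lookup (rewire a b v) i ≡ a
    rewire-i a b v rewrite lookup∘tabulate (λ x → if does (x ≟ i) then a else if does (x ≟ j) then b else lookup v x) i
                         | dec-true (i ≟ i) refl = refl

    rewire-j : i ≢ j → ∀ a b v → lookup (rewire a b v) j ≡ b
    rewire-j i≢j a b v rewrite lookup∘tabulate (λ x → if does (x ≟ i) then a else if does (x ≟ j) then b else lookup v x) j
                         | dec-false (j ≟ i) (i≢j ∘ sym) | dec-true (j ≟ j) refl = refl

    rewire-other : ∀ a b v {x} → x ≢ i → x ≢ j → lookup (rewire a b v) x ≡ lookup v x
    rewire-other a b v {x} x≢i x≢j
      rewrite lookup∘tabulate (λ x → if does (x ≟ i) then a else if does (x ≟ j) then b else lookup v x) x
            | dec-false (x ≟ i) x≢i | dec-false (x ≟ j) x≢j = refl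

    -- Makes the case distinction between i, j and the other points once for all later proofs about
    -- rewired vectors.
    rewire-elim : i ≢ j → ∀ {ℓ} a b v (R : Fin N → Fin N → Set ℓ) → R i a → R j b →
                  (∀ x → x ≢ i → x ≢ j → R x (lookup v x)) → ∀ x → R x (lookup (rewire a b v) x)
    rewire-elim i≢j a b v R ri rj rx x with x ≟ i | x ≟ j
    ... | yes refl | _        = subst (R i) (sym (rewire-i a b v)) ri
    ... | no  _    | yes refl = subst (R j) (sym (rewire-j i≢j a b v)) rj
    ... | no  x≢i  | no x≢j   = subst (R x) (sym (rewire-other a b v x≢i x≢j)) (rx x x≢i x≢j)

    cut link : Vec (Fin N) N → Vec (Fin N) N
    cut  = rewire i j
    link = rewire j i

    remove-other : ∀ (S : Fin N → Bool) x → x ≢ i → x ≢ j → (S − i − j) x ≡ S x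
    remove-other S x x≢i x≢j rewrite dec-false (x ≟ i) x≢i | dec-false (x ≟ j) x≢j with S x
    ... | true  = refl
    ... | false = refl

    remove-i : ∀ (S : Fin N → Bool) → (S − i − j) i ≡ false
    remove-i S rewrite dec-true (i ≟ i) refl with S i
    ... | true  = refl
    ... | false = refl

    remove-j : ∀ (S : Fin N → Bool) → (S − i − j) j ≡ false
    remove-j S rewrite dec-true (j ≟ j) refl with S j ∧ not (does (j ≟ i))
    ... | true  = refl
    ... | false = refl

    -- Since v is an involution exchanging i and j, it sends no other point to either of them; so
    -- the change at i and j does not disturb the rest.
    Involution-cut : i ≢ j → ∀ S v → Involution S v × j ≡ lookup v i →
                     Involution (S − i − j) (cut v) × link (cut v) ≡ v
    Involution-cut i≢j S v (inv , j≡vi) = involutive , lookup-ext (λ x →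
        rewire-elim i≢j j i (cut v) (λ x y → y ≡ lookup v x) j≡vi (sym vj≡i) (λ x → rewire-other i j v) x)
      where
      vj≡i : lookup v j ≡ i
      vj≡i = trans (cong (lookup v) j≡vi) (proj₁ (inv i))
      involutive : Involution (S − i − j) (cut v)
      involutive = rewire-elim i≢j i j v (λ x y → lookup (cut v) y ≡ x × does (y ≟ x) ≡ not ((S − i − j) x))
        (rewire-i i j v , trans (dec-true (i ≟ i) refl) (sym (cong not (remove-i S))))
        (rewire-j i≢j i j v , trans (dec-true (j ≟ j) refl) (sym (cong not (remove-j S))))
        (λ x x≢i x≢j → trans (rewire-other i j v
             (λ vx≡i → x≢j (trans (sym (proj₁ (inv x))) (trans (cong (lookup v) vx≡i) (sym j≡vi))))
             (λ vx≡j → x≢i (trans (sym (proj₁ (inv x))) (trans (cong (lookup v) vx≡j) vj≡i))))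
             (proj₁ (inv x))
           , trans (proj₂ (inv x)) (cong not (sym (remove-other S x x≢i x≢j))))

    Involution-fixed : ∀ {S : Fin N → Bool} u → Involution S u → ∀ x → S x ≡ false → lookup u x ≡ x
    Involution-fixed u inv x e = does⇒ (lookup u x ≟ x) (trans (proj₂ (inv x)) (cong not e))

    Involution-link : i ≢ j → ∀ S → S i ≡ true → S j ≡ true → ∀ u → Involution (S − i − j) u →
                      (Involution S (link u) × j ≡ lookup (link u) i) × cut (link u) ≡ u
    Involution-link i≢j S Si Sj u inv = (involutive , sym (rewire-i j i u)) , lookup-ext (λ x →
        rewire-elim i≢j i j (link u) (λ x y → y ≡ lookup u x) (sym ui≡i) (sym uj≡j) (λ x → rewire-other j i u) x)
      where
      ui≡i = Involution-fixed u inv i (remove-i S)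
      uj≡j = Involution-fixed u inv j (remove-j S)
      involutive : Involution S (link u)
      involutive = rewire-elim i≢j j i u (λ x y → lookup (link u) y ≡ x × does (y ≟ x) ≡ not (S x))
        (rewire-j i≢j j i u , trans (dec-false (j ≟ i) (i≢j ∘ sym)) (sym (cong not Si)))
        (rewire-i j i u , trans (dec-false (i ≟ j) i≢j) (sym (cong not Sj)))
        (λ x x≢i x≢j → trans (rewire-other j i u
             (λ ux≡i → x≢i (trans (sym (proj₁ (inv x))) (trans (cong (lookup u) ux≡i) ui≡i)))
             (λ ux≡j → x≢j (trans (sym (proj₁ (inv x))) (trans (cong (lookup u) ux≡j) uj≡j))))
             (proj₁ (inv x))
           , trans (proj₂ (inv x)) (cong not (remove-other S x x≢i x≢j)))

    ∑-link : i ≢ j → ∀ S → S i ≡ true → S j ≡ true → ∀ (f : Vec (Fin N) N → ℕ) →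
             ∑ (allVecs N N) (λ v → 𝟙 (does (j ≟ lookup v i)) * (𝟙 (does (involution? S v)) * f v))
             ≡ ∑ (allVecs N N) (λ u → 𝟙 (does (involution? (S − i − j) u)) * f (link u))
    ∑-link i≢j S Si Sj f = trans
      (∑-cong (allVecs N N) (λ v → trans (sym (*-assoc (𝟙 (does (j ≟ lookup v i))) _ _)) (cong (_* f v)
         (trans (*-comm (𝟙 (does (j ≟ lookup v i))) (𝟙 (does (involution? S v)))) (sym (𝟙-∧ (does (involution? S v)) (does (j ≟ lookup v i))))))))
      (∑-reindex _≟ⱽ_ (allVecs N N) (enumerates-allVecs N N) (λ v → involution? S v ×-dec (j ≟ lookup v i)) (involution? (S − i − j))
         cut link (Involution-cut i≢j S) (Involution-link i≢j S Si Sj) f)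

  -- Containing pairs and the deletion of one point

  _is_ : Side → Side → Bool
  left  is left  = true
  inner is inner = true
  right is right = true
  _     is _     = false

  is⇒≡ : ∀ s t → s is t ≡ true → s ≡ t
  is⇒≡ left  left  _ = refl
  is⇒≡ inner inner _ = refl
  is⇒≡ right right _ = refl

  sideOf : Bool → Bool → Side
  sideOf true  _     = left
  sideOf false true  = right
  sideOf false false = inner

  -- A pair across the given pair is counted at its left end only, and either of the two points may
  -- be that end; hence two summands of which at most one is 1.
  across-sideOf : ∀ l r l′ r′ → l ∧ r ≡ false → l′ ∧ r′ ≡ false →
                  𝟙 (l ∧ r′) + 𝟙 (l′ ∧ r) ≡ 𝟙 (across (sideOf l r) (sideOf l′ r′))
  across-sideOf true  false true  false _ _ = refl
  across-sideOf true  false false true  _ _ = refl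
  across-sideOf true  false false false _ _ = refl
  across-sideOf false true  true  false _ _ = refl
  across-sideOf false true  false true  _ _ = refl
  across-sideOf false true  false false _ _ = refl
  across-sideOf false false true  false _ _ = refl
  across-sideOf false false false true  _ _ = refl
  across-sideOf false false false false _ _ = refl

  ltF-true : ∀ {N} {a b : Fin N} → toℕ a < toℕ b → ltF a b ≡ true
  ltF-true {a = a} {b} a<b with ltF a b | <⇒<ᵇ a<b
  ... | true | _ = refl

  ltF⇒< : ∀ {N} (a b : Fin N) → ltF a b ≡ true → toℕ a < toℕ b
  ltF⇒< a b e = <ᵇ⇒< (toℕ a) (toℕ b) (subst T (sym e) tt)

  ∑F-point : ∀ {N} (i : Fin N) c → ∑F (λ a → 𝟙 (does (a ≟ i)) * c) ≡ c
  ∑F-point {N} i c = enumerates-allFin N i (λ _ → c)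

  module _ {N : ℕ} (S : Fin N → Bool) (i : Fin N) (Si : S i ≡ true) where

    ∑-remove : ∀ (f : Fin N → ℕ) → ∑F (λ a → 𝟙 (S a) * f a) ≡ f i + ∑F (λ a → 𝟙 ((S − i) a) * f a)
    ∑-remove f = trans (∑-cong (allFin N) pointwise) (trans (∑-+ (allFin N) _ _)
        (cong (_+ ∑F (λ a → 𝟙 ((S − i) a) * f a)) (enumerates-allFin N i f)))
      where
      pointwise : ∀ a → 𝟙 (S a) * f a ≡ 𝟙 (does (a ≟ i)) * f a + 𝟙 ((S − i) a) * f a
      pointwise a with a ≟ i
      ... | yes refl rewrite Si = sym (+-identityʳ _)
      ... | no  _ with S a
      ...   | true  = refl
      ...   | false = refl

  module _ {N : ℕ} (g h : Fin N) (g<h : toℕ g < toℕ h) where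

    sides-exclusive : ∀ a → ltF a g ∧ ltF h a ≡ false
    sides-exclusive a with ltF a g in e₁ | ltF h a in e₂
    ... | true  | true  = contradiction (<-trans (ltF⇒< a g e₁) g<h) (<⇒≯ (ltF⇒< h a e₂))
    ... | true  | false = refl
    ... | false | _     = refl

    side : Fin N → Side
    side a = sideOf (ltF a g) (ltF h a)

    -- `h` is a parameter instead of the partner of `g`, so that the number also makes sense for the
    -- matchings of the remaining points, which fix g and h.
    containing : Vec (Fin N) N → ℕ
    containing v = ∑F (λ a → 𝟙 (ltF a g ∧ ltF h (lookup v a)))

    -- A fixed point contributes nothing, as it cannot lie left of g and right of h at once. Linking
    -- two fixed points therefore adds just the contribution of the new pair.
    containing-link : ∀ i j u → i ≢ j → lookup u i ≡ i → lookup u j ≡ j →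
                      containing (link i j u) ≡ 𝟙 (across (side i) (side j)) + containing u
    containing-link i j u i≢j ui≡i uj≡j = begin
        ∑F (λ a → 𝟙 (ltF a g ∧ ltF h (lookup (link i j u) a)))
      ≡⟨ ∑-cong (allFin N) (rewire-elim i j i≢j j i u
           (λ a b → 𝟙 (ltF a g ∧ ltF h b) ≡ 𝟙 (does (a ≟ i)) * A + 𝟙 (does (a ≟ j)) * B + old a) at-i at-j other) ⟩
        ∑F (λ a → 𝟙 (does (a ≟ i)) * A + 𝟙 (does (a ≟ j)) * B + old a)
      ≡⟨ ∑-+ (allFin N) (λ a → 𝟙 (does (a ≟ i)) * A + 𝟙 (does (a ≟ j)) * B) old ⟩
        ∑F (λ a → 𝟙 (does (a ≟ i)) * A + 𝟙 (does (a ≟ j)) * B) + containing u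
      ≡⟨ cong (_+ containing u) (trans (∑-+ (allFin N) (λ a → 𝟙 (does (a ≟ i)) * A) (λ a → 𝟙 (does (a ≟ j)) * B))
           (cong₂ _+_ (∑F-point i A) (∑F-point j B))) ⟩
        A + B + containing u
      ≡⟨ cong (_+ containing u) (across-sideOf (ltF i g) (ltF h i) (ltF j g) (ltF h j) (sides-exclusive i) (sides-exclusive j)) ⟩
        𝟙 (across (side i) (side j)) + containing u ∎
      where
      open ≡-Reasoning
      A = 𝟙 (ltF i g ∧ ltF h j)
      B = 𝟙 (ltF j g ∧ ltF h i)
      old : Fin N → ℕ
      old a = 𝟙 (ltF a g ∧ ltF h (lookup u a))
      old-fixed : ∀ a → lookup u a ≡ a → old a ≡ 0
      old-fixed a e rewrite e = cong 𝟙 (sides-exclusive a)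
      at-i : A ≡ 𝟙 (does (i ≟ i)) * A + 𝟙 (does (i ≟ j)) * B + old i
      at-i rewrite dec-true (i ≟ i) refl | dec-false (i ≟ j) i≢j | old-fixed i ui≡i =
        solve 1 (λ a → a := con 1 :* a :+ con 0 :+ con 0) refl A
      at-j : B ≡ 𝟙 (does (j ≟ i)) * A + 𝟙 (does (j ≟ j)) * B + old j
      at-j rewrite dec-true (j ≟ j) refl | dec-false (j ≟ i) (i≢j ∘ sym) | old-fixed j uj≡j =
        solve 1 (λ a → a := con 0 :+ con 1 :* a :+ con 0) refl B
      other : ∀ a → a ≢ i → a ≢ j → old a ≡ 𝟙 (does (a ≟ i)) * A + 𝟙 (does (a ≟ j)) * B + old a
      other a a≢i a≢j rewrite dec-false (a ≟ i) a≢i | dec-false (a ≟ j) a≢j = refl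

    matchings : (Fin N → Bool) → ℕ → ℕ
    matchings S p = ∑ (allVecs N N) (λ v → 𝟙 (does (involution? S v)) * kronecker (containing v) p)

    matchings-link : ∀ i j → i ≢ j → ∀ S → S i ≡ true → S j ≡ true → ∀ p →
             ∑ (allVecs N N) (λ v → 𝟙 (does (j ≟ lookup v i)) * (𝟙 (does (involution? S v)) * kronecker (containing v) p))
             ≡ shift (across (side i) (side j)) (matchings (S − i − j)) p
    matchings-link i j i≢j S Si Sj p = begin
        ∑ V (λ v → 𝟙 (does (j ≟ lookup v i)) * (𝟙 (does (involution? S v)) * kronecker (containing v) p))
      ≡⟨ ∑-link i j i≢j S Si Sj (λ v → kronecker (containing v) p) ⟩
        ∑ V (λ u → 𝟙 (does (involution? S′ u)) * kronecker (containing (link i j u)) p)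
      ≡⟨ ∑-cong V (λ u → 𝟙-*-cong (does (involution? S′ u)) (λ e → pointwise u (does⇒ (involution? S′ u) e))) ⟩
        ∑ V (λ u → 𝟙 (does (involution? S′ u)) * shift b (kronecker (containing u)) p)
      ≡⟨ shift-∑ b V (λ u → 𝟙 (does (involution? S′ u))) (λ u → kronecker (containing u)) p ⟩
        shift b (matchings S′) p ∎
      where
      open ≡-Reasoning
      V = allVecs N N
      S′ = S − i − j
      b = across (side i) (side j)
      pointwise : ∀ u → Involution S′ u → kronecker (containing (link i j u)) p ≡ shift b (kronecker (containing u)) p
      pointwise u inv = trans
        (cong (λ c → kronecker c p) (containing-link i j u i≢j
          (Involution-fixed i j u inv i (remove-i i j S)) (Involution-fixed i j u inv j (remove-j i j S))))
        (kronecker-shift b (containing u) p)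

    -- Splits by the partner j of i. A point j outside S is fixed and i itself is moved, so neither
    -- can be the partner and both give 0.
    matchings-remove : ∀ i S → S i ≡ true → ∀ p →
               matchings S p ≡ ∑F (λ j → 𝟙 ((S − i) j) * shift (across (side i) (side j)) (matchings (S − i − j)) p)
    matchings-remove i S Si p = begin
        ∑ V F
      -- The delta introduces the partner j as a summation variable, which is then moved outside the
      -- sum over v.
      ≡⟨ ∑-cong V (λ v → sym (enumerates-allFin N (lookup v i) (λ _ → F v))) ⟩
        ∑ V (λ v → ∑F (λ j → 𝟙 (does (j ≟ lookup v i)) * F v))
      ≡⟨ ∑-comm V (allFin N) _ ⟩
        ∑F (λ j → ∑ V (λ v → 𝟙 (does (j ≟ lookup v i)) * F v))
      ≡⟨ ∑-cong (allFin N) partner ⟩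
        ∑F (λ j → 𝟙 ((S − i) j) * shift (across (side i) (side j)) (matchings (S − i − j)) p) ∎
      where
      open ≡-Reasoning
      V = allVecs N N
      F : Vec (Fin N) N → ℕ
      F v = 𝟙 (does (involution? S v)) * kronecker (containing v) p
      vanish : ∀ j → (∀ v → Involution S v → j ≢ lookup v i) →
               ∑ V (λ v → 𝟙 (does (j ≟ lookup v i)) * F v) ≡ 0
      vanish j no-link = trans (∑-cong V term) (∑-0 V)
        where
        term : ∀ v → 𝟙 (does (j ≟ lookup v i)) * F v ≡ 0
        term v = at (involution? S v)
          where
          at : (d : Dec (Involution S v)) → 𝟙 (does (j ≟ lookup v i)) * (𝟙 (does d) * kronecker (containing v) p) ≡ 0
          at (no  _)   = *-zeroʳ (𝟙 (does (j ≟ lookup v i)))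
          at (yes inv) rewrite dec-false (j ≟ lookup v i) (no-link v inv) = refl
      matched : ∀ v → Involution S v → ∀ x → S x ≡ true → lookup v x ≢ x
      matched v inv x e = does⇏ (lookup v x ≟ x) (trans (proj₂ (inv x)) (cong not e))
      partner : ∀ j → ∑ V (λ v → 𝟙 (does (j ≟ lookup v i)) * F v)
                      ≡ 𝟙 ((S − i) j) * shift (across (side i) (side j)) (matchings (S − i − j)) p
      partner j with S j in Sj | j ≟ i
      ... | false | _        = vanish j (λ v inv j≡vi → matched v inv i Si
            (trans (sym j≡vi) (trans (sym (Involution-fixed i i v inv j Sj)) (trans (cong (lookup v) j≡vi) (proj₁ (inv i))))))
      ... | true  | yes refl = vanish j (λ v inv i≡vi → matched v inv i Si (sym i≡vi))
      ... | true  | no  j≢i  = trans (matchings-link i j (j≢i ∘ sym) S Si Sj p) (sym (+-identityʳ _))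

    count : (Fin N → Bool) → Side → ℕ
    count S s = ∑F (λ a → 𝟙 (S a) * 𝟙 (side a is s))

    count-remove : ∀ S i → S i ≡ true → ∀ s → count S s ≡ 𝟙 (side i is s) + count (S − i) s
    count-remove S i Si s = ∑-remove S i Si (λ a → 𝟙 (side a is s))

    ∑-by-side : ∀ S (Φ : Side → ℕ) → ∑F (λ j → 𝟙 (S j) * Φ (side j))
                ≡ count S left * Φ left + count S inner * Φ inner + count S right * Φ right
    ∑-by-side S Φ = begin
        ∑F (λ j → 𝟙 (S j) * Φ (side j))
      ≡⟨ ∑-cong (allFin N) (λ j → split (𝟙 (S j)) (side j)) ⟩
        ∑F (λ j → t left j + t inner j + t right j)
      ≡⟨ trans (∑-+ (allFin N) (λ j → t left j + t inner j) (t right))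
           (cong (_+ ∑F (t right)) (∑-+ (allFin N) (t left) (t inner))) ⟩
        ∑F (t left) + ∑F (t inner) + ∑F (t right)
      ≡⟨ cong₂ _+_ (cong₂ _+_ (pull left) (pull inner)) (pull right) ⟩
        count S left * Φ left + count S inner * Φ inner + count S right * Φ right ∎
      where
      open ≡-Reasoning
      t : Side → Fin N → ℕ
      t s j = 𝟙 (S j) * 𝟙 (side j is s) * Φ s
      pull : ∀ s → ∑F (t s) ≡ count S s * Φ s
      pull s = ∑-*ʳ (allFin N) (Φ s) (λ j → 𝟙 (S j) * 𝟙 (side j is s))
      split : ∀ c s → c * Φ s ≡ c * 𝟙 (s is left) * Φ left + c * 𝟙 (s is inner) * Φ inner + c * 𝟙 (s is right) * Φ right
      split c left  = solve 4 (λ c x y z → c :* x := c :* con 1 :* x :+ c :* con 0 :* y :+ c :* con 0 :* z) refl c (Φ left) (Φ inner) (Φ right)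
      split c inner = solve 4 (λ c x y z → c :* y := c :* con 0 :* x :+ c :* con 1 :* y :+ c :* con 0 :* z) refl c (Φ left) (Φ inner) (Φ right)
      split c right = solve 4 (λ c x y z → c :* z := c :* con 0 :* x :+ c :* con 0 :* y :+ c :* con 1 :* z) refl c (Φ left) (Φ inner) (Φ right)

    size : (Fin N → Bool) → ℕ
    size S = count S left + count S inner + count S right

    size-remove : ∀ S i → S i ≡ true → size S ≡ suc (size (S − i))
    size-remove S i Si rewrite count-remove S i Si left | count-remove S i Si inner | count-remove S i Si right with side i
    ... | left  = refl
    ... | inner = cong (_+ count (S − i) right) (+-suc (count (S − i) left) _)
    ... | right = +-suc (count (S − i) left + count (S − i) inner) _

    count-positive : ∀ S s {n} → count S s ≡ suc n → ∃ λ i → S i ≡ true × side i ≡ s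
    count-positive S s e with ∑-positive (allFin N) (λ a → 𝟙 (S a) * 𝟙 (side a is s)) e
    ... | i , m , q with S i in Si | side i is s in q′
    ...   | true | true = i , Si , is⇒≡ (side i) s q′

    size-0 : ∀ S → size S ≡ 0 → ∀ i → S i ≡ false
    size-0 S e i with S i in Si
    ... | false = refl
    ... | true  = contradiction (trans (sym (size-remove S i Si)) e) (λ ())

    -- The identity is the only vector that fixes every point, and it has no containing pair.
    matchings-empty : ∀ S → (∀ i → S i ≡ false) → ∀ p → matchings S p ≡ M 0 0 0 0 p
    matchings-empty S empty p = begin
        ∑ V (λ v → 𝟙 (does (involution? S v)) * kronecker (containing v) p)
      ≡⟨ ∑-cong V (λ v → cong (λ b → 𝟙 b * kronecker (containing v) p) (does-⇔ (involution? S v) (v ≟ⱽ ι) (to v) (from v))) ⟩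
        ∑ V (λ v → 𝟙 (does (v ≟ⱽ ι)) * kronecker (containing v) p)
      ≡⟨ enumerates-allVecs N N ι _ ⟩
        kronecker (containing ι) p
      ≡⟨ cong (λ c → kronecker c p) (trans (∑-cong (allFin N) (λ a → cong 𝟙 (trans
           (cong (λ b → ltF a g ∧ ltF h b) (lookup∘tabulate id a)) (sides-exclusive a)))) (∑-0 (allFin N))) ⟩
        kronecker 0 p
      ≡⟨ base p ⟩
        M 0 0 0 0 p ∎
      where
      open ≡-Reasoning
      V = allVecs N N
      ι = tabulate id
      to : ∀ v → Involution S v → v ≡ ι
      to v inv = lookup-ext (λ x → trans (Involution-fixed x x v inv x (empty x)) (sym (lookup∘tabulate id x)))
      from : ∀ v → v ≡ ι → Involution S v
      from v refl x = trans (lookup∘tabulate id (lookup ι x)) ιx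
                    , trans (dec-true (lookup ι x ≟ x) ιx) (cong not (sym (empty x)))
        where
        ιx : lookup ι x ≡ x
        ιx = lookup∘tabulate id x
      base : ∀ p → kronecker 0 p ≡ M 0 0 0 0 p
      base zero    = refl
      base (suc p) = refl

    -- Quantified over S because the induction passes to all the sets left after the deletion of a
    -- point and its partner.
    Counted : ℕ → Set
    Counted k = ∀ S → size S ≡ double k → ∀ p → matchings S p ≡ M k (count S left) (count S inner) (count S right) p

    matchings-removal : ∀ k → Counted k → ∀ i S → S i ≡ true → size (S − i) ≡ suc (double k) → ∀ p →
                matchings S p ≡ removal (side i) (M k) (count (S − i) left) (count (S − i) inner) (count (S − i) right) p
    matchings-removal k ih i S Si size≡ p = begin
        matchings S p
      ≡⟨ matchings-remove i S Si p ⟩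
        ∑F (λ j → 𝟙 (R j) * shift (across (side i) (side j)) (matchings (R − j)) p)
      ≡⟨ ∑-cong (allFin N) (λ j → 𝟙-*-cong (R j) (λ Rj → shift-cong (across (side i) (side j)) (smaller j Rj) p)) ⟩
        ∑F (λ j → 𝟙 (R j) * Φ (side j))
      ≡⟨ ∑-by-side R Φ ⟩
        removal (side i) (M k) (count R left) (count R inner) (count R right) p ∎
      where
      open ≡-Reasoning
      R = S − i
      -- The arguments of `M` after a partner on the given side is gone, written with `pred` to
      -- agree with `removal`. For an actual partner that count is a successor.
      partnerless : Side → ℕ → ℕ
      partnerless left  = M k (pred (count R left)) (count R inner) (count R right)
      partnerless inner = M k (count R left) (pred (count R inner)) (count R right)
      partnerless right = M k (count R left) (count R inner) (pred (count R right))
      Φ : Side → ℕ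
      Φ s = shift (across (side i) s) (partnerless s) p
      smaller : ∀ j → R j ≡ true → ∀ q → matchings (R − j) q ≡ partnerless (side j) q
      smaller j Rj q = trans (ih (R − j) (suc-injective (trans (sym (size-remove R j Rj)) size≡)) q) lemma
        where
        lemma : M k (count (R − j) left) (count (R − j) inner) (count (R − j) right) q ≡ partnerless (side j) q
        lemma with side j | count-remove R j Rj left | count-remove R j Rj inner | count-remove R j Rj right
        ... | left  | e₁ | e₂ | e₃ rewrite e₁ | e₂ | e₃ = refl
        ... | inner | e₁ | e₂ | e₃ rewrite e₁ | e₂ | e₃ = refl
        ... | right | e₁ | e₂ | e₃ rewrite e₁ | e₂ | e₃ = refl

    matchings≡M : ∀ k → Counted k
    matchings≡M zero S size≡ p
      rewrite matchings-empty S (size-0 S size≡) p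
            | m+n≡0⇒m≡0 (count S left) (m+n≡0⇒m≡0 (count S left + count S inner) size≡)
            | m+n≡0⇒n≡0 (count S left) (m+n≡0⇒m≡0 (count S left + count S inner) size≡)
            | m+n≡0⇒n≡0 (count S left + count S inner) size≡ = refl
    matchings≡M (suc k) S size≡ p = cases (count S left) (count S inner) (count S right) refl refl refl
      where
      removed : ∀ i → S i ≡ true → matchings S p ≡ removal (side i) (M k) (count (S − i) left) (count (S − i) inner) (count (S − i) right) p
      removed i Si = matchings-removal k (matchings≡M k) i S Si (suc-injective (trans (sym (size-remove S i Si)) size≡)) p

      split : ∀ i → S i ≡ true → ∀ s {n} → side i ≡ s → ∀ t → count S t ≡ n → n ≡ 𝟙 (s is t) + count (S − i) t
      split i Si s refl t e = trans (sym e) (count-remove S i Si t)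

      -- The cases follow the clauses of `M`: the deleted point is inner if possible, otherwise
      -- left, otherwise right. No point at all contradicts the size 2 k + 2.
      cases : ∀ x w r → count S left ≡ x → count S inner ≡ w → count S right ≡ r → matchings S p ≡ M (suc k) x w r p
      cases x (suc w) r x≡ w≡ r≡ with count-positive S inner w≡
      ... | i , Si , s≡ = trans (removed i Si) (lemma (side i) s≡ (split i Si inner s≡ left x≡) (split i Si inner s≡ inner w≡) (split i Si inner s≡ right r≡))
        where
        -- Stated for variables in place of the side and the counts after deletion, which do not
        -- reduce, so that the equations can be matched with `refl`.
        lemma : ∀ s {x′ w′ r′} → s ≡ inner → x ≡ x′ → suc w ≡ suc w′ → r ≡ r′ → removal s (M k) x′ w′ r′ p ≡ M (suc k) x (suc w) r p
        lemma _ refl refl refl refl = refl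
      cases (suc x) zero r x≡ w≡ r≡ with count-positive S left x≡
      ... | i , Si , s≡ = trans (removed i Si) (lemma (side i) s≡ (split i Si left s≡ left x≡) (split i Si left s≡ inner w≡) (split i Si left s≡ right r≡))
        where
        lemma : ∀ s {x′ w′ r′} → s ≡ left → suc x ≡ suc x′ → 0 ≡ w′ → r ≡ r′ → removal s (M k) x′ w′ r′ p ≡ M (suc k) (suc x) 0 r p
        lemma _ refl refl refl refl = refl
      cases zero zero (suc r) x≡ w≡ r≡ with count-positive S right r≡
      ... | i , Si , s≡ = trans (removed i Si) (lemma (side i) s≡ (split i Si right s≡ left x≡) (split i Si right s≡ inner w≡) (split i Si right s≡ right r≡))
        where
        lemma : ∀ s {x′ w′ r′} → s ≡ right → 0 ≡ x′ → 0 ≡ w′ → suc r ≡ suc r′ → removal s (M k) x′ w′ r′ p ≡ M (suc k) 0 0 (suc r) p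
        lemma _ refl refl refl refl = refl
      cases zero zero zero x≡ w≡ r≡ = contradiction (trans (sym size≡) (cong₂ _+_ (cong₂ _+_ x≡ w≡) r≡)) (λ ())

  -- Boolean tests of the definitions and the sizes of the three sides

  All-foldr : ∀ {a} {A : Set a} (P : A → Bool) (xs : List A) →
              List.foldr (λ x r → P x ∧ r) true xs ≡ true → All (λ x → P x ≡ true) xs
  All-foldr P []       e = []
  All-foldr P (x ∷ xs) e with P x in q
  ... | true = q ∷ All-foldr P xs e

  foldr-All : ∀ {a} {A : Set a} (P : A → Bool) {xs : List A} → All (λ x → P x ≡ true) xs →
              List.foldr (λ x r → P x ∧ r) true xs ≡ true
  foldr-All P []       = refl
  foldr-All P (e ∷ es) rewrite e = foldr-All P es

  everywhere : ∀ {N} → Fin N → Bool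
  everywhere _ = true

  ≡does : ∀ {a} {A : Set a} {b} (d : Dec A) → (b ≡ true → A) → (A → b ≡ true) → b ≡ does d
  ≡does {b = true}  d       f g = sym (dec-true d (f refl))
  ≡does {b = false} (no _)  f g = refl
  ≡does {b = false} (yes x) f g = g x

  eqF≡does : ∀ {N} (a b : Fin N) → eqF a b ≡ does (a ≟ b)
  eqF≡does a b = ≡does (a ≟ b)
    (λ e → toℕ-injective (≡ᵇ⇒≡ (toℕ a) (toℕ b) (subst T (sym e) tt)))
    (λ { refl → Equivalence.to T-≡ (≡⇒≡ᵇ (toℕ a) (toℕ a) refl) })

  isMatching≡ : ∀ {N} (v : Vec (Fin N) N) → isMatching v ≡ does (involution? everywhere v)
  isMatching≡ {N} v = ≡does (involution? everywhere v)
      (λ e x → inv x (All.tabulate⁻ (All-foldr P (allFin N) e) x))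
      (λ inv → foldr-All P {allFin N} (All.tabulate⁺ (P-true inv)))
    where
    P : Fin N → Bool
    P x = not (eqF (lookup v x) x) ∧ eqF (lookup v (lookup v x)) x
    inv : ∀ x → P x ≡ true → lookup v (lookup v x) ≡ x × does (lookup v x ≟ x) ≡ false
    inv x q rewrite eqF≡does (lookup v x) x with does (lookup v x ≟ x) | eqF≡does (lookup v (lookup v x)) x
    ... | false | e′ = does⇒ (lookup v (lookup v x) ≟ x) (trans (sym e′) q) , refl
    P-true : Involution everywhere v → ∀ x → P x ≡ true
    P-true inv x rewrite eqF≡does (lookup v x) x | eqF≡does (lookup v (lookup v x)) x
                       | proj₂ (inv x) | dec-true (lookup v (lookup v x) ≟ x) (proj₁ (inv x)) = refl

  -- The bound a < v a follows from a < g < h < v a, so three tests amount to two.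
  nContaining≡ : ∀ {N} (g h : Fin N) (g<h : toℕ g < toℕ h) v → h ≡ lookup v g → nContaining v g ≡ containing g h g<h v
  nContaining≡ {N} g h g<h v refl = trans (length-filter (allFin N) _) (∑-cong (allFin N) (λ a → cong 𝟙 (simplify a)))
    where
    simplify : ∀ a → ltF a (lookup v a) ∧ ltF a g ∧ ltF h (lookup v a) ≡ ltF a g ∧ ltF h (lookup v a)
    simplify a with ltF a g in e₁ | ltF h (lookup v a) in e₂
    ... | true  | true  rewrite ltF-true {a = a} {lookup v a} (<-trans (ltF⇒< a g e₁) (<-trans g<h (ltF⇒< h (lookup v a) e₂))) = refl
    ... | true  | false with ltF a (lookup v a)
    ...   | true  = refl
    ...   | false = refl
    simplify a | false | _ with ltF a (lookup v a)
    ...   | true  = refl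
    ...   | false = refl

  ∑F-cong : ∀ {N} {f f′ : Fin N → ℕ} → (∀ x → f x ≡ f′ x) → ∑F f ≡ ∑F f′
  ∑F-cong {N} = ∑-cong (allFin N)

  ltF-irrefl : ∀ {N} (a : Fin N) → ltF a a ≡ false
  ltF-irrefl a with ltF a a in e
  ... | false = refl
  ... | true  = contradiction (ltF⇒< a a e) (<-irrefl refl)

  ltF-asym : ∀ {N} (a b : Fin N) → toℕ a < toℕ b → ltF b a ≡ false
  ltF-asym a b a<b with ltF b a in e
  ... | false = refl
  ... | true  = contradiction (ltF⇒< b a e) (<-asym a<b)

  ∑F-below : ∀ {N} (g : Fin N) → ∑F (λ a → 𝟙 (ltF a g)) ≡ toℕ g
  ∑F-below {suc N} zero    = ∑-0 (allFin (suc N))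
  ∑F-below {suc N} (suc g) = trans (∑F-suc (λ a → 𝟙 (ltF a (suc g)))) (cong suc (∑F-below g))

  ∑F-1 : ∀ N → ∑F {N} (λ _ → 1) ≡ N
  ∑F-1 zero    = refl
  ∑F-1 (suc N) = trans (∑F-suc {N} (λ _ → 1)) (cong suc (∑F-1 N))

  ∑F-above : ∀ {N} (h : Fin N) → ∑F (λ a → 𝟙 (ltF h a)) ≡ N ∸ suc (toℕ h)
  ∑F-above {suc N} zero    = trans (∑F-suc (λ a → 𝟙 (ltF {suc N} zero a))) (∑F-1 N)
  ∑F-above {suc N} (suc h) = trans (∑F-suc (λ a → 𝟙 (ltF (suc h) a))) (∑F-above h)

  module _ {N : ℕ} (g h : Fin N) (g<h : toℕ g < toℕ h) where

    private
      others : Fin N → Bool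
      others = everywhere − g − h

    side-g : side g h g<h g ≡ inner
    side-g rewrite ltF-irrefl g | ltF-asym g h g<h = refl

    side-h : side g h g<h h ≡ inner
    side-h rewrite ltF-irrefl h | ltF-asym g h g<h = refl

    h-remains : (everywhere − g) h ≡ true
    h-remains = cong not (dec-false (h ≟ g) (λ h≡g → <-irrefl (cong toℕ (sym h≡g)) g<h))

    -- By the definition of `sideOf`, g and h count as inner. For the left and right sides the two
    -- indicators compute to 0, and the counts over `others` are those over all points.
    count-everywhere : ∀ s → count g h g<h everywhere s ≡ 𝟙 (inner is s) + (𝟙 (inner is s) + count g h g<h others s)
    count-everywhere s = begin
        count g h g<h everywhere s
      ≡⟨ count-remove g h g<h everywhere g refl s ⟩
        𝟙 (side g h g<h g is s) + count g h g<h (everywhere − g) s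
      ≡⟨ cong (λ c → 𝟙 (side g h g<h g is s) + c) (count-remove g h g<h (everywhere − g) h h-remains s) ⟩
        𝟙 (side g h g<h g is s) + (𝟙 (side g h g<h h is s) + count g h g<h others s)
      ≡⟨ cong₂ (λ a b → 𝟙 (a is s) + (𝟙 (b is s) + count g h g<h others s)) side-g side-h ⟩
        𝟙 (inner is s) + (𝟙 (inner is s) + count g h g<h others s) ∎
      where open ≡-Reasoning

    count-left : count g h g<h others left ≡ toℕ g
    count-left = trans (sym (count-everywhere left)) (trans (∑F-cong pointwise) (∑F-below g))
      where
      pointwise : ∀ a → 1 * 𝟙 (side g h g<h a is left) ≡ 𝟙 (ltF a g)
      pointwise a with ltF a g | ltF h a
      ... | true  | _     = refl
      ... | false | true  = refl
      ... | false | false = refl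

    count-right : count g h g<h others right ≡ N ∸ suc (toℕ h)
    count-right = trans (sym (count-everywhere right)) (trans (∑F-cong pointwise) (∑F-above h))
      where
      pointwise : ∀ a → 1 * 𝟙 (side g h g<h a is right) ≡ 𝟙 (ltF h a)
      pointwise a with ltF a g | ltF h a | sides-exclusive g h g<h a
      ... | true  | false | _ = refl
      ... | false | true  | _ = refl
      ... | false | false | _ = refl

    size-others : 2 + size g h g<h others ≡ N
    size-others = begin
        2 + size g h g<h others
      ≡⟨ cong suc (sym (size-remove g h g<h (everywhere − g) h h-remains)) ⟩
        1 + size g h g<h (everywhere − g)
      ≡⟨ sym (size-remove g h g<h everywhere g refl) ⟩
        size g h g<h everywhere
      ≡⟨ solve 3 (λ a b c → a :+ b :+ c := a :* con 1 :+ b :* con 1 :+ c :* con 1) refl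
           (count g h g<h everywhere left) (count g h g<h everywhere inner) (count g h g<h everywhere right) ⟩
        count g h g<h everywhere left * 1 + count g h g<h everywhere inner * 1 + count g h g<h everywhere right * 1
      ≡⟨ sym (∑-by-side g h g<h everywhere (λ _ → 1)) ⟩
        ∑F {N} (λ _ → 1)
      ≡⟨ ∑F-1 N ⟩
        N ∎
      where open ≡-Reasoning

    -- Obtained by subtraction: the left and right counts are known and the total is N - 2.
    count-inner : count g h g<h others inner ≡ toℕ h ∸ suc (toℕ g)
    count-inner = sym (trans (cong (_∸ suc (toℕ g)) h≡) (m+n∸m≡n (suc (toℕ g)) w))
      where
      open ≡-Reasoning
      w = count g h g<h others inner
      r = N ∸ suc (toℕ h)
      h≡ : toℕ h ≡ suc (toℕ g) + w
      h≡ = +-cancelʳ-≡ (suc r) (toℕ h) (suc (toℕ g) + w) (begin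
          toℕ h + suc r
        ≡⟨ +-suc (toℕ h) r ⟩
          suc (toℕ h) + r
        ≡⟨ m+[n∸m]≡n (toℕ<n h) ⟩
          N
        ≡⟨ sym size-others ⟩
          2 + (count g h g<h others left + w + count g h g<h others right)
        ≡⟨ cong₂ (λ a b → 2 + (a + w + b)) count-left count-right ⟩
          2 + (toℕ g + w + r)
        ≡⟨ cong suc (sym (+-suc (toℕ g + w) r)) ⟩
          suc (toℕ g) + w + suc r ∎)

  -- Summation over the given pair

  ∑F-Σ₂ : ∀ N f → ∑F {suc N} (λ a → f (toℕ a) (suc N ∸ suc (toℕ a))) ≡ Σ₂ N f
  ∑F-Σ₂ zero    f = +-identityʳ (f 0 0)
  ∑F-Σ₂ (suc N) f = trans (∑F-suc {suc N} (λ a → f (toℕ a) (suc (suc N) ∸ suc (toℕ a))))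
    (cong (f 0 (suc N) +_) (∑F-Σ₂ N (λ a → f (suc a))))

  pairSum : ∀ N → (ℕ → ℕ → ℕ → ℕ) → ℕ
  pairSum N f = ∑F {N} (λ g → ∑F {N} (λ h → 𝟙 (ltF g h) * f (toℕ g) (toℕ h ∸ suc (toℕ g)) (N ∸ suc (toℕ h))))

  pairSum-suc : ∀ N f → pairSum (suc N) f ≡ ∑F {N} (λ h → f 0 (toℕ h) (N ∸ suc (toℕ h))) + pairSum N (λ a → f (suc a))
  pairSum-suc N f = trans (∑F-suc {N} (λ g → ∑F (row g))) (cong₂ _+_
      (trans (∑F-suc (row zero)) (∑F-cong {N} (λ h → +-identityʳ _)))
      (∑F-cong {N} (λ g → ∑F-suc (row (suc g)))))
    where
    row : Fin (suc N) → Fin (suc N) → ℕ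
    row g h = 𝟙 (ltF g h) * f (toℕ g) (toℕ h ∸ suc (toℕ g)) (suc N ∸ suc (toℕ h))

  -- A pair g < h among N + 2 points is determined by the sizes of its three gaps, which add up to
  -- N. The pairs starting at the first point form the layer x = 0.
  pairSum≡Σ₃ : ∀ N f → pairSum (2 + N) f ≡ Σ₃ N f
  pairSum≡Σ₃ zero    f = trans (pairSum-suc 1 f) (trans (+-identityʳ _) (+-identityʳ (f 0 0 0)))
  pairSum≡Σ₃ (suc N) f = trans (pairSum-suc (2 + N) f) (cong₂ _+_ (∑F-Σ₂ (suc N) (f 0)) (pairSum≡Σ₃ N (λ a → f (suc a))))

  G≡∑ : ∀ n p → G n p ≡ ∑ (allVecs (2 * n) (2 * n)) (λ v → 𝟙 (does (involution? everywhere v))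
                          * ∑F (λ g → 𝟙 (ltF g (lookup v g)) * kronecker (nContaining v g) p))
  G≡∑ n p = begin
      G n p
    ≡⟨ length-filter (Configs n) (λ c → nContaining (proj₁ c) (proj₂ c) ≡ᵇ p) ⟩
      ∑ (Configs n) weight
    ≡⟨ ∑-concatMap (filter (λ v → T? (isMatching v)) V) choices weight ⟩
      ∑ (filter (λ v → T? (isMatching v)) V) (λ v → ∑ (choices v) weight)
    ≡⟨ ∑-filter V isMatching (λ v → ∑ (choices v) weight) ⟩
      ∑ V (λ v → 𝟙 (isMatching v) * ∑ (choices v) weight)
    ≡⟨ ∑-cong V (λ v → cong₂ _*_ (cong 𝟙 (isMatching≡ v))
         (trans (∑-map (filter (λ g → T? (ltF g (lookup v g))) (allFin N)) (v ,_) weight)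
                (∑-filter (allFin N) (λ g → ltF g (lookup v g)) (λ g → weight (v , g))))) ⟩
      ∑ V (λ v → 𝟙 (does (involution? everywhere v)) * ∑F (λ g → 𝟙 (ltF g (lookup v g)) * kronecker (nContaining v g) p)) ∎
    where
    open ≡-Reasoning
    N = 2 * n
    V = allVecs N N
    weight : Vec (Fin N) N × Fin N → ℕ
    weight c = 𝟙 (nContaining (proj₁ c) (proj₂ c) ≡ᵇ p)
    choices : Vec (Fin N) N → List (Vec (Fin N) N × Fin N)
    choices v = map (v ,_) (filter (λ g → T? (ltF g (lookup v g))) (allFin N))

  -- Configurations are listed with the matching first, whereas `M` fixes the given pair first. A
  -- delta for the partner h of g lets the sums be exchanged.
  ∑-given : ∀ N k p → N ≡ 2 + double k →
            ∑ (allVecs N N) (λ v → 𝟙 (does (involution? everywhere v))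
               * ∑F (λ g → 𝟙 (ltF g (lookup v g)) * kronecker (nContaining v g) p))
            ≡ pairSum N (λ x w r → M k x w r p)
  ∑-given N k p N≡ = begin
      ∑ V (λ v → I v * ∑F (λ g → 𝟙 (ltF g (lookup v g)) * kr v g))
    ≡⟨ ∑-cong V (λ v → trans (sym (∑-*ˡ (allFin N) (I v) _)) (∑F-cong (λ g → trans (cong (I v *_)
         (sym (enumerates-allFin N (lookup v g) (λ h → 𝟙 (ltF g h) * kr v g)))) (sym (∑-*ˡ (allFin N) (I v) _))))) ⟩
      ∑ V (λ v → ∑F (λ g → ∑F (λ h → I v * (𝟙 (does (h ≟ lookup v g)) * (𝟙 (ltF g h) * kr v g)))))
    ≡⟨ trans (∑-comm V (allFin N) _) (∑F-cong {N} (λ g → ∑-comm V (allFin N) (λ v h → I v * (𝟙 (does (h ≟ lookup v g)) * (𝟙 (ltF g h) * kr v g))))) ⟩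
      ∑F (λ g → ∑F (λ h → ∑ V (λ v → I v * (𝟙 (does (h ≟ lookup v g)) * (𝟙 (ltF g h) * kr v g)))))
    ≡⟨ ∑F-cong (λ g → ∑F-cong (λ h → trans
         (∑-cong V (λ v → solve 4 (λ a b c d → a :* (b :* (c :* d)) := c :* (b :* (a :* d))) refl (I v) (𝟙 (does (h ≟ lookup v g))) (𝟙 (ltF g h)) (kr v g)))
         (trans (∑-*ˡ V (𝟙 (ltF g h)) _) (𝟙-*-cong (ltF g h) (λ e → fixed-given g h (ltF⇒< g h e)))))) ⟩
      pairSum N (λ x w r → M k x w r p) ∎
    where
    open ≡-Reasoning
    V = allVecs N N
    I : Vec (Fin N) N → ℕ
    I v = 𝟙 (does (involution? everywhere v))
    kr : Vec (Fin N) N → Fin N → ℕ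
    kr v g = kronecker (nContaining v g) p
    fixed-given : ∀ g h → toℕ g < toℕ h → ∑ V (λ v → 𝟙 (does (h ≟ lookup v g)) * (I v * kr v g))
                  ≡ M k (toℕ g) (toℕ h ∸ suc (toℕ g)) (N ∸ suc (toℕ h)) p
    fixed-given g h g<h = begin
        ∑ V (λ v → 𝟙 (does (h ≟ lookup v g)) * (I v * kr v g))
      ≡⟨ ∑-cong V (λ v → 𝟙-*-cong (does (h ≟ lookup v g)) (λ e →
           cong (λ c → I v * kronecker c p) (nContaining≡ g h g<h v (does⇒ (h ≟ lookup v g) e)))) ⟩
        ∑ V (λ v → 𝟙 (does (h ≟ lookup v g)) * (I v * kronecker (containing g h g<h v) p))
      -- The given pair is deleted by the same lemma as any other. Both its ends count as inner, so
      -- the shift is trivial and the pair does not count itself.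
      ≡⟨ matchings-link g h g<h g h (λ g≡h → <-irrefl (cong toℕ g≡h) g<h) everywhere refl refl p ⟩
        shift (across (side g h g<h g) (side g h g<h h)) (matchings g h g<h others) p
      ≡⟨ cong₂ (λ s t → shift (across s t) (matchings g h g<h others) p) (side-g g h g<h) (side-h g h g<h) ⟩
        matchings g h g<h others p
      ≡⟨ matchings≡M g h g<h k others (suc-injective (suc-injective (trans (size-others g h g<h) N≡))) p ⟩
        M k (count g h g<h others left) (count g h g<h others inner) (count g h g<h others right) p
      ≡⟨ cong₂ (λ a b → M k a (count g h g<h others inner) b p) (count-left g h g<h) (count-right g h g<h) ⟩
        M k (toℕ g) (count g h g<h others inner) (N ∸ suc (toℕ h)) p
      ≡⟨ cong (λ w → M k (toℕ g) w (N ∸ suc (toℕ h)) p) (count-inner g h g<h) ⟩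
        M k (toℕ g) (toℕ h ∸ suc (toℕ g)) (N ∸ suc (toℕ h)) p ∎
      where
      others : Fin N → Bool
      others = everywhere − g − h

  G≡Total : ∀ k p → G (suc k) p ≡ Total k p
  G≡Total k p = begin
      G (suc k) p
    ≡⟨ G≡∑ (suc k) p ⟩
      _
    ≡⟨ ∑-given (2 * suc k) k p N≡ ⟩
      pairSum (2 * suc k) f
    ≡⟨ cong (λ N → pairSum N f) N≡ ⟩
      pairSum (2 + double k) f
    ≡⟨ pairSum≡Σ₃ (double k) f ⟩
      Total k p ∎
    where
    open ≡-Reasoning
    f : ℕ → ℕ → ℕ → ℕ
    f x w r = M k x w r p
    N≡ : 2 * suc k ≡ 2 + double k
    N≡ = trans (cong (suc k +_) (+-identityʳ (suc k))) (sym (double≡+ (suc k)))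

-- Power series over a semiring, and the equations behind the closed form

module Semirings where
  open import Algebra.Bundles using (CommutativeSemiring)
  open import Algebra.Structures.Biased using (module IsCommutativeSemiringˡ)
  import Algebra.Construct.Pointwise as Pointwise
  open import Data.Nat using (zero; suc)
  open import Data.Product using (_,_)

  module PowerSeries {c ℓ} (R : CommutativeSemiring c ℓ) where
    open CommutativeSemiring R
    open import Relation.Binary.Reasoning.Setoid setoid
    open import Algebra.Solver.Ring.NaturalCoefficients.Default R using (solve; _:+_; _:*_; _:=_)

    Series : Set c
    Series = ℕ → Carrier

    infix 4 _≋_
    _≋_ : Series → Series → Set ℓ
    f ≋ g = ∀ n → f n ≈ g n

    tail : Series → Series
    tail f n = f (suc n)

    infixl 7 _✶_
    -- The Cauchy product by recursion on the index, taking off the head of the left factor. The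
    -- laws become structural inductions free of truncated subtraction.
    _✶_ : Series → Series → Series
    (f ✶ g) zero    = f 0 * g 0
    (f ✶ g) (suc n) = f 0 * g (suc n) + (tail f ✶ g) n

    unit : Series
    unit zero    = 1#
    unit (suc _) = 0#

    ✶-cong : ∀ {f f′ g g′} → f ≋ f′ → g ≋ g′ → f ✶ g ≋ f′ ✶ g′
    ✶-cong p q zero    = *-cong (p 0) (q 0)
    ✶-cong p q (suc n) = +-cong (*-cong (p 0) (q (suc n))) (✶-cong (λ n → p (suc n)) q n)

    -- The mirror image of the defining recursion; commutativity is the comparison of the two.
    ✶-suc : ∀ f g n → (f ✶ g) (suc n) ≈ f (suc n) * g 0 + (f ✶ tail g) n
    ✶-suc f g zero    = +-comm _ _
    ✶-suc f g (suc n) = begin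
        f 0 * g (suc (suc n)) + (tail f ✶ g) (suc n)
      ≈⟨ +-congˡ (✶-suc (tail f) g n) ⟩
        f 0 * g (suc (suc n)) + (f (suc (suc n)) * g 0 + (tail f ✶ tail g) n)
      ≈⟨ solve 3 (λ a b c → a :+ (b :+ c) := b :+ (a :+ c)) refl (f 0 * g (suc (suc n))) (f (suc (suc n)) * g 0) ((tail f ✶ tail g) n) ⟩
        f (suc (suc n)) * g 0 + (f 0 * g (suc (suc n)) + (tail f ✶ tail g) n) ∎

    ✶-comm : ∀ f g → f ✶ g ≋ g ✶ f
    ✶-comm f g zero    = *-comm _ _
    ✶-comm f g (suc n) = trans (+-cong (*-comm _ _) (✶-comm (tail f) g n)) (sym (✶-suc g f n))

    ✶-distribʳ : ∀ f g h → (λ n → g n + h n) ✶ f ≋ (λ n → (g ✶ f) n + (h ✶ f) n)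
    ✶-distribʳ f g h zero    = distribʳ (f 0) (g 0) (h 0)
    ✶-distribʳ f g h (suc n) = begin
        (g 0 + h 0) * f (suc n) + ((λ n → tail g n + tail h n) ✶ f) n
      ≈⟨ +-congˡ (✶-distribʳ f (tail g) (tail h) n) ⟩
        (g 0 + h 0) * f (suc n) + ((tail g ✶ f) n + (tail h ✶ f) n)
      ≈⟨ solve 5 (λ a b c d e → (a :+ b) :* c :+ (d :+ e) := (a :* c :+ d) :+ (b :* c :+ e)) refl (g 0) (h 0) (f (suc n)) ((tail g ✶ f) n) ((tail h ✶ f) n) ⟩
        (g 0 * f (suc n) + (tail g ✶ f) n) + (h 0 * f (suc n) + (tail h ✶ f) n) ∎

    ✶-scale : ∀ c f g → (λ n → c * f n) ✶ g ≋ (λ n → c * (f ✶ g) n)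
    ✶-scale c f g zero    = *-assoc c (f 0) (g 0)
    ✶-scale c f g (suc n) = trans (+-cong (*-assoc c (f 0) (g (suc n))) (✶-scale c (tail f) g n)) (sym (distribˡ c _ _))

    ✶-assoc : ∀ f g h → (f ✶ g) ✶ h ≋ f ✶ (g ✶ h)
    ✶-assoc f g h zero    = *-assoc (f 0) (g 0) (h 0)
    ✶-assoc f g h (suc n) = begin
        f 0 * g 0 * h (suc n) + ((λ n → f 0 * tail g n + (tail f ✶ g) n) ✶ h) n
      ≈⟨ +-congˡ (✶-distribʳ h (λ n → f 0 * tail g n) (tail f ✶ g) n) ⟩
        f 0 * g 0 * h (suc n) + (((λ n → f 0 * tail g n) ✶ h) n + ((tail f ✶ g) ✶ h) n)
      ≈⟨ +-congˡ (+-cong (✶-scale (f 0) (tail g) h n) (✶-assoc (tail f) g h n)) ⟩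
        f 0 * g 0 * h (suc n) + (f 0 * (tail g ✶ h) n + (tail f ✶ (g ✶ h)) n)
      ≈⟨ solve 5 (λ a b c d e → a :* b :* c :+ (a :* d :+ e) := a :* (b :* c :+ d) :+ e) refl (f 0) (g 0) (h (suc n)) ((tail g ✶ h) n) ((tail f ✶ (g ✶ h)) n) ⟩
        f 0 * (g 0 * h (suc n) + (tail g ✶ h) n) + (tail f ✶ (g ✶ h)) n ∎

    ✶-zeroˡ : ∀ f → (λ _ → 0#) ✶ f ≋ (λ _ → 0#)
    ✶-zeroˡ f zero    = zeroˡ (f 0)
    ✶-zeroˡ f (suc n) = trans (+-cong (zeroˡ (f (suc n))) (✶-zeroˡ f n)) (+-identityˡ 0#)

    ✶-identityˡ : ∀ f → unit ✶ f ≋ f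
    ✶-identityˡ f zero    = *-identityˡ (f 0)
    ✶-identityˡ f (suc n) = trans (+-cong (*-identityˡ (f (suc n))) (✶-zeroˡ f n)) (+-identityʳ _)

    ✶-constant : ∀ {f} → tail f ≋ (λ _ → 0#) → ∀ g n → (f ✶ g) n ≈ f 0 * g n
    ✶-constant e g zero    = refl
    ✶-constant e g (suc n) = trans (+-congˡ (trans (✶-cong e (λ _ → refl) n) (✶-zeroˡ g n))) (+-identityʳ _)

    ✶-variable : ∀ {f} → f 0 ≈ 0# → tail f ≋ unit → ∀ g n → (f ✶ g) (suc n) ≈ g n
    ✶-variable e e′ g n = trans (+-cong (trans (*-congʳ e) (zeroˡ _)) (trans (✶-cong e′ (λ _ → refl) n) (✶-identityˡ g n))) (+-identityˡ _)

    commutativeSemiring : CommutativeSemiring c ℓ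
    commutativeSemiring = record
      { _≈_ = _≋_
      ; _+_ = λ f g n → f n + g n
      ; _*_ = _✶_
      ; 0#  = λ _ → 0#
      ; 1#  = unit
      ; isCommutativeSemiring = IsCommutativeSemiringˡ.isCommutativeSemiring (record
        { +-isCommutativeMonoid = Pointwise.isCommutativeMonoid ℕ +-isCommutativeMonoid
        ; *-isCommutativeMonoid = record
          { isMonoid = record
            { isSemigroup = record
              { isMagma = record
                { isEquivalence = Pointwise.isEquivalence ℕ isEquivalence
                ; ∙-cong = ✶-cong
                }
              ; assoc = ✶-assoc
              }
            ; identity = ✶-identityˡ , λ f n → trans (✶-comm f unit n) (✶-identityˡ f n)
            }
          ; comm = ✶-comm
          }
        ; distribʳ = ✶-distribʳ
        ; zeroˡ = ✶-zeroˡ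
        })
      }

  module Elimination {c ℓ} (R : CommutativeSemiring c ℓ) where
    open CommutativeSemiring R
    open import Relation.Binary.Reasoning.Setoid setoid
    open import Algebra.Solver.Ring.NaturalCoefficients.Default R using (solve; _:+_; _:*_; _:=_; con)

    -- u = 1 - t, v = 1 - y, Q = 1 - z (1 + y) and g = 1 / (1 - t), stated without subtraction
    -- so that the semiring solver applies; primes stand for θ.
    module Logarithm
      (cancel : ∀ x {y z} → y + x ≈ z + x → y ≈ z)
      {z y t u v Q W g : Carrier}
      (u+t : u + t ≈ 1#) (v+y : v + y ≈ 1#) (t≈ : t ≈ z + z)
      (Q+ : Q + z * (1# + y) ≈ 1#) (W+1 : W + 1# ≈ Q * g) (ug : u * g ≈ 1#) where

      -- Brings an equation for (1 - t) x into the form x = t x + ..., from which a recurrence can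
      -- be read off, without subtracting.
      u-absorb : ∀ x → x ≈ t * x + u * x
      u-absorb x = begin
        x                ≈⟨ *-identityˡ x ⟨
        1# * x           ≈⟨ *-congʳ u+t ⟨
        (u + t) * x      ≈⟨ solve 3 (λ u t x → (u :+ t) :* x := t :* x :+ u :* x) refl u t x ⟩
        t * x + u * x    ∎

      uW+u : u * W + u ≈ Q
      uW+u = begin
        u * W + u      ≈⟨ solve 2 (λ u W → u :* W :+ u := u :* (W :+ con 1)) refl u W ⟩
        u * (W + 1#)   ≈⟨ *-congˡ W+1 ⟩
        u * (Q * g)    ≈⟨ solve 3 (λ u Q g → u :* (Q :* g) := u :* g :* Q) refl u Q g ⟩
        u * g * Q      ≈⟨ *-congʳ ug ⟩
        1# * Q         ≈⟨ *-identityˡ Q ⟩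
        Q              ∎

      -- This is z (1 - y) + (1 - 2z) = 1 - z (1 + y), verified after adding z (1 + y) to both
      -- sides.
      zv+u : z * v + u ≈ Q
      zv+u = cancel (z * (1# + y)) (begin
        z * v + u + z * (1# + y)
          ≈⟨ solve 5 (λ z v u o y → z :* v :+ u :+ z :* (o :+ y) := u :+ (z :* (v :+ y) :+ z :* o)) refl z v u 1# y ⟩
        u + (z * (v + y) + z * 1#)
          ≈⟨ +-congˡ (+-cong (trans (*-congˡ v+y) (*-identityʳ z)) (*-identityʳ z)) ⟩
        u + (z + z)             ≈⟨ +-congˡ t≈ ⟨
        u + t                   ≈⟨ u+t ⟩
        1#                      ≈⟨ Q+ ⟨
        Q + z * (1# + y)        ∎)

      uW : u * W ≈ z * v
      uW = cancel u (trans uW+u (sym zv+u))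

      -- The hypotheses are `uW` differentiated, using θz = z and θv = 0, and θu = -t.
      module _ {W′ u′ : Carrier} (θuW : u′ * W + u * W′ ≈ z * v) (u′+t : u′ + t ≈ 0#) where

        uW′ : u * W′ ≈ z * v + t * W
        uW′ = begin
          u * W′                          ≈⟨ +-identityˡ _ ⟨
          0# + u * W′                     ≈⟨ +-congʳ (trans (*-congʳ u′+t) (zeroˡ W)) ⟨
          (u′ + t) * W + u * W′           ≈⟨ solve 5 (λ u′ t W u W′ → (u′ :+ t) :* W :+ u :* W′ := (u′ :* W :+ u :* W′) :+ t :* W) refl u′ t W u W′ ⟩
          (u′ * W + u * W′) + t * W       ≈⟨ +-congʳ θuW ⟩
          z * v + t * W                   ∎

        module _ {L′ : Carrier} (θL : L′ + L′ * W ≈ W′) where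

          -- Q = u (1 + W) supplies the factor 1 + W that turns L′ into W′. What remains, u (z v) +
          -- t (z v), is z v because u + t = 1.
          QuL′ : Q * (u * L′) ≈ z * v
          QuL′ = begin
            Q * (u * L′)                    ≈⟨ *-congʳ uW+u ⟨
            (u * W + u) * (u * L′)          ≈⟨ solve 3 (λ u W L → (u :* W :+ u) :* (u :* L) := u :* (u :* (L :+ L :* W))) refl u W L′ ⟩
            u * (u * (L′ + L′ * W))         ≈⟨ *-congˡ (trans (*-congˡ θL) uW′) ⟩
            u * (z * v + t * W)             ≈⟨ solve 4 (λ u x t W → u :* (x :+ t :* W) := u :* x :+ t :* (u :* W)) refl u (z * v) t W ⟩
            u * (z * v) + t * (u * W)       ≈⟨ +-congˡ (*-congˡ uW) ⟩
            u * (z * v) + t * (z * v)       ≈⟨ +-comm _ _ ⟩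
            t * (z * v) + u * (z * v)       ≈⟨ u-absorb (z * v) ⟨
            z * v                           ∎

          module _ {E B B′ L : Carrier} (vE : v * E ≈ 1#) (uB′ : u * B′ ≈ z * B) where

            correction : Carrier
            correction = E * (B * (u * L′))

            -- Multiplication by Q leaves E v z B by `QuL′`, and E v = 1.
            correction-equation : correction ≈ z * B + z * (1# + y) * correction
            correction-equation = begin
              correction                                                ≈⟨ *-identityˡ _ ⟨
              1# * correction                                           ≈⟨ *-congʳ Q+ ⟨
              (Q + z * (1# + y)) * correction                           ≈⟨ distribʳ correction Q _ ⟩
              Q * correction + z * (1# + y) * correction                ≈⟨ +-congʳ (begin
                Q * (E * (B * (u * L′)))    ≈⟨ solve 4 (λ Q E B x → Q :* (E :* (B :* x)) := E :* (B :* (Q :* x))) refl Q E B (u * L′) ⟩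
                E * (B * (Q * (u * L′)))    ≈⟨ *-congˡ (*-congˡ QuL′) ⟩
                E * (B * (z * v))           ≈⟨ solve 4 (λ E B z v → E :* (B :* (z :* v)) := v :* E :* (z :* B)) refl E B z v ⟩
                v * E * (z * B)             ≈⟨ *-congʳ vE ⟩
                1# * (z * B)                ≈⟨ *-identityˡ _ ⟩
                z * B                       ∎) ⟩
              z * B + z * (1# + y) * correction                         ∎

            product-equation : ∀ {P′} → P′ ≈ E * (B′ * L + B * L′) →
                               P′ ≈ t * P′ + (z * (E * (B * L)) + correction)
            product-equation {P′} e = trans (u-absorb P′) (+-congˡ (begin
              u * P′                                        ≈⟨ *-congˡ e ⟩
              u * (E * (B′ * L + B * L′))                   ≈⟨ solve 6 (λ u E B′ L B L′ → u :* (E :* (B′ :* L :+ B :* L′)) := E :* (u :* B′ :* L :+ B :* (u :* L′))) refl u E B′ L B L′ ⟩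
              E * (u * B′ * L + B * (u * L′))               ≈⟨ *-congˡ (+-congʳ (*-congʳ uB′)) ⟩
              E * (z * B * L + B * (u * L′))                ≈⟨ solve 5 (λ E z B L x → E :* (z :* B :* L :+ B :* x) := z :* (E :* (B :* L)) :+ E :* (B :* x)) refl E z B L (u * L′) ⟩
              z * (E * (B * L)) + correction                ∎))

-- Rational series in two variables: the derivation θ and composition

module Series where
  open Semirings
  open import Algebra.Bundles using (CommutativeSemiring; CommutativeRing)
  open import Algebra.Structures.Biased using (module IsCommutativeSemiringˡ)
  open import Data.Nat as ℕ using (zero; suc; _∸_; _≤_; _<_; z≤n; s≤s; NonZero; _!)
  import Data.Nat.Properties as ℕ
  open import Data.Nat.Properties using (_!≢0)
  import Data.Integer as ℤ
  import Data.Integer.Properties as ℤ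
  open import Data.Rational using (ℚ; 0ℚ; 1ℚ; _+_; _*_; _-_; -_; _/_; toℚᵘ)
  open import Data.Rational.Properties
  import Data.Rational.Unnormalised as ℚᵘ
  import Data.Rational.Unnormalised.Properties as ℚᵘ
  open import Data.Product using (Σ; _,_; proj₁)
  open import Data.Sum using (inj₁; inj₂)
  open import Level using (0ℓ)
  open import Relation.Binary.PropositionalEquality

  ℚ-semiring : CommutativeSemiring 0ℓ 0ℓ
  ℚ-semiring = CommutativeRing.commutativeSemiring +-*-commutativeRing


  open import Algebra.Solver.Ring.NaturalCoefficients.Default ℚ-semiring using (solve; _:+_; _:*_; _:=_; con)

  fromℕ : ℕ → ℚ
  fromℕ n = ℤ.+ n / 1

  private
    fromℕ-toℚᵘ : ∀ n → toℚᵘ (fromℕ n) ℚᵘ.≃ ℚᵘ.mkℚᵘ (ℤ.+ n) 0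
    fromℕ-toℚᵘ n = toℚᵘ-fromℚᵘ (ℚᵘ.mkℚᵘ (ℤ.+ n) 0)

  -- `_/_` normalises by a gcd that is stuck on variables, so the identity is checked on
  -- unnormalised fractions.
  fromℕ-+ : ∀ m n → fromℕ (m ℕ.+ n) ≡ fromℕ m + fromℕ n
  fromℕ-+ m n = toℚᵘ-injective (ℚᵘ.≃-trans (fromℕ-toℚᵘ (m ℕ.+ n)) (ℚᵘ.≃-sym (ℚᵘ.≃-trans (toℚᵘ-homo-+ (fromℕ m) (fromℕ n))
    (ℚᵘ.≃-trans (ℚᵘ.+-cong (fromℕ-toℚᵘ m) (fromℕ-toℚᵘ n))
      (ℚᵘ.*≡* (cong (ℤ._* ℤ.1ℤ) (cong₂ ℤ._+_ (ℤ.*-identityʳ (ℤ.+ m)) (ℤ.*-identityʳ (ℤ.+ n)))))))))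

  fromℕ-* : ∀ m n → fromℕ (m ℕ.* n) ≡ fromℕ m * fromℕ n
  fromℕ-* m n = toℚᵘ-injective (ℚᵘ.≃-trans (fromℕ-toℚᵘ (m ℕ.* n)) (ℚᵘ.≃-sym (ℚᵘ.≃-trans (toℚᵘ-homo-* (fromℕ m) (fromℕ n))
    (ℚᵘ.≃-trans (ℚᵘ.*-cong (fromℕ-toℚᵘ m) (fromℕ-toℚᵘ n))
      (ℚᵘ.*≡* (cong (ℤ._* ℤ.1ℤ) (sym (ℤ.pos-* m n))))))))

  /-cancel : ∀ a m .{{_ : NonZero m}} → fromℕ m * (ℤ.+ a / m) ≡ fromℕ a
  /-cancel a (suc d) = toℚᵘ-injective (ℚᵘ.≃-trans (toℚᵘ-homo-* (fromℕ (suc d)) (ℤ.+ a / suc d))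
    (ℚᵘ.≃-trans (ℚᵘ.*-cong (fromℕ-toℚᵘ (suc d)) (toℚᵘ-fromℚᵘ (ℚᵘ.mkℚᵘ (ℤ.+ a) d)))
    (ℚᵘ.≃-trans (ℚᵘ.*≡* (trans (ℤ.*-identityʳ _) (trans (ℤ.*-comm (ℤ.+ suc d) (ℤ.+ a)) (cong (λ k → ℤ.+ a ℤ.* ℤ.+ suc k) (sym (ℕ.+-identityʳ d))))))
    (ℚᵘ.≃-sym (fromℕ-toℚᵘ a)))))

  *-cancelˡ-fromℕ : ∀ m .{{_ : NonZero m}} {x y} → fromℕ m * x ≡ fromℕ m * y → x ≡ y
  *-cancelˡ-fromℕ m {x} {y} e = trans (sym (undo x)) (trans (cong ((ℤ.+ 1 / m) *_) e) (undo y))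
    where
    undo : ∀ x → (ℤ.+ 1 / m) * (fromℕ m * x) ≡ x
    undo x = trans (sym (*-assoc (ℤ.+ 1 / m) (fromℕ m) x))
      (trans (cong (_* x) (trans (*-comm (ℤ.+ 1 / m) (fromℕ m)) (/-cancel 1 m))) (*-identityˡ x))

  sumTo-cong : ∀ n {f g} → (∀ k → k ≤ n → f k ≡ g k) → sumTo n f ≡ sumTo n g
  sumTo-cong zero    e = e 0 z≤n
  sumTo-cong (suc n) e = cong₂ _+_ (sumTo-cong n (λ k k≤n → e k (ℕ.m≤n⇒m≤1+n k≤n))) (e (suc n) ℕ.≤-refl)

  sumTo-suc : ∀ n f → sumTo (suc n) f ≡ f 0 + sumTo n (λ k → f (suc k))
  sumTo-suc zero    f = refl
  sumTo-suc (suc n) f = trans (cong (_+ f (suc (suc n))) (sumTo-suc n f)) (+-assoc (f 0) _ _)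

  sumTo-+ : ∀ n f g → sumTo n (λ k → f k + g k) ≡ sumTo n f + sumTo n g
  sumTo-+ zero    f g = refl
  sumTo-+ (suc n) f g = trans (cong (_+ (f (suc n) + g (suc n))) (sumTo-+ n f g))
    (solve 4 (λ a b c d → a :+ b :+ (c :+ d) := a :+ c :+ (b :+ d)) refl (sumTo n f) (sumTo n g) (f (suc n)) (g (suc n)))

  sumTo-* : ∀ n c f → sumTo n (λ k → c * f k) ≡ c * sumTo n f
  sumTo-* zero    c f = refl
  sumTo-* (suc n) c f = trans (cong (_+ c * f (suc n)) (sumTo-* n c f)) (sym (*-distribˡ-+ c (sumTo n f) (f (suc n))))

  sumTo-0 : ∀ n → sumTo n (λ _ → 0ℚ) ≡ 0ℚ
  sumTo-0 zero    = refl
  sumTo-0 (suc n) = trans (+-identityʳ _) (sumTo-0 n)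

  sumTo-comm : ∀ m n (f : ℕ → ℕ → ℚ) → sumTo m (λ a → sumTo n (f a)) ≡ sumTo n (λ b → sumTo m (λ a → f a b))
  sumTo-comm zero    n f = refl
  sumTo-comm (suc m) n f = trans (cong (_+ sumTo n (f (suc m))) (sumTo-comm m n f)) (sym (sumTo-+ n _ (f (suc m))))

  sumTo-extend : ∀ n N f → n ≤ N → (∀ k → n < k → f k ≡ 0ℚ) → sumTo n f ≡ sumTo N f
  sumTo-extend n zero    f z≤n vanish = refl
  sumTo-extend n (suc N) f n≤N vanish with ℕ.m≤n⇒m<n∨m≡n n≤N
  ... | inj₂ refl = refl
  ... | inj₁ (s≤s n≤N′) = trans (sumTo-extend n N f n≤N′ vanish)
        (trans (sym (+-identityʳ _)) (cong (sumTo N f +_) (sym (vanish (suc N) (s≤s n≤N′)))))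

  module Z = PowerSeries ℚ-semiring
  module YZ = PowerSeries Z.commutativeSemiring

  convolution : ∀ n f g → sumTo n (λ b → f b * g (n ∸ b)) ≡ (f Z.✶ g) n
  convolution zero    f g = refl
  convolution (suc n) f g = trans (sumTo-suc n (λ b → f b * g (suc n ∸ b))) (cong (f 0 * g (suc n) +_) (convolution n (Z.tail f) g))

  convolution₂ : ∀ i n (F H : FPS) → sumTo i (λ a → (F a Z.✶ H (i ∸ a)) n) ≡ (F YZ.✶ H) i n
  convolution₂ zero    n F H = refl
  convolution₂ (suc i) n F H = trans (sumTo-suc i (λ a → (F a Z.✶ H (suc i ∸ a)) n))
    (cong ((F 0 Z.✶ H (suc i)) n +_) (convolution₂ i n (YZ.tail F) H))

  infix 4 _≃_
  _≃_ : FPS → FPS → Set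
  F ≃ H = ∀ i n → F i n ≡ H i n

  ⊛-✶ : ∀ F H → F ⊛ H ≃ F YZ.✶ H
  ⊛-✶ F H i n = trans (sumTo-cong i (λ a _ → convolution n (F a) (H (i ∸ a)))) (convolution₂ i n F H)

  1S : FPS
  1S = constS 1ℚ

  1S-unit : 1S ≃ YZ.unit
  1S-unit zero    zero    = refl
  1S-unit zero    (suc n) = refl
  1S-unit (suc i) zero    = refl
  1S-unit (suc i) (suc n) = refl

  private module YZS = CommutativeSemiring YZ.commutativeSemiring

  -- The laws are transported from series in y over series in z. The product stays `_⊛_` itself, so
  -- the solver and the elimination apply to the very terms of `rhsS`.
  fps-semiring : CommutativeSemiring 0ℓ 0ℓ
  fps-semiring = record
    { Carrier = FPS
    ; _≈_ = _≃_
    ; _+_ = _⊕_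
    ; _*_ = _⊛_
    ; 0#  = λ _ _ → 0ℚ
    ; 1#  = 1S
    ; isCommutativeSemiring = IsCommutativeSemiringˡ.isCommutativeSemiring (record
      { +-isCommutativeMonoid = YZS.+-isCommutativeMonoid
      ; *-isCommutativeMonoid = record
        { isMonoid = record
          { isSemigroup = record
            { isMagma = record
              { isEquivalence = YZS.isEquivalence
              ; ∙-cong = ⊛-cong′
              }
            ; assoc = λ F H J → via (⊛-✶ (F ⊛ H) J) (YZS.trans (YZS.*-congʳ (⊛-✶ F H))
                (YZS.trans (YZS.*-assoc F H J) (YZS.*-congˡ {F} (YZS.sym (⊛-✶ H J))))) (⊛-✶ F (H ⊛ J))
            }
          ; identity = identity′ , λ F i n → trans (comm′ F 1S i n) (identity′ F i n)
          }
        ; comm = comm′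
        }
      ; distribʳ = λ F H J → via (⊛-✶ (H ⊕ J) F) (YZS.distribʳ F H J) (λ i n → cong₂ _+_ (⊛-✶ H F i n) (⊛-✶ J F i n))
      ; zeroˡ = λ F → YZS.trans (⊛-✶ (λ _ _ → 0ℚ) F) (YZS.zeroˡ F)
      })
    }
    where
    via : ∀ {F F′ H H′ : FPS} → F ≃ F′ → F′ ≃ H′ → H ≃ H′ → F ≃ H
    via p q r i n = trans (p i n) (trans (q i n) (sym (r i n)))
    ⊛-cong′ : ∀ {F F′ H H′} → F ≃ F′ → H ≃ H′ → F ⊛ H ≃ F′ ⊛ H′
    ⊛-cong′ {F} {F′} {H} {H′} p q = via (⊛-✶ F H) (YZS.*-cong p q) (⊛-✶ F′ H′)
    comm′ : ∀ F H → F ⊛ H ≃ H ⊛ F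
    comm′ F H = via (⊛-✶ F H) (YZS.*-comm F H) (⊛-✶ H F)
    identity′ : ∀ F → 1S ⊛ F ≃ F
    identity′ F = YZS.trans (⊛-✶ 1S F) (YZS.trans (YZS.*-congʳ 1S-unit) (YZS.*-identityˡ F))

  module FS = CommutativeSemiring fps-semiring

  θ : FPS → FPS
  θ F i n = fromℕ n * F i n

  θ-cong : ∀ {F H} → F ≃ H → θ F ≃ θ H
  θ-cong e i n = cong (fromℕ n *_) (e i n)

  θ-⊕ : ∀ F H → θ (F ⊕ H) ≃ θ F ⊕ θ H
  θ-⊕ F H i n = *-distribˡ-+ (fromℕ n) (F i n) (H i n)

  -- Inside the convolution n splits as b + (n - b), one part for each factor.
  θ-⊛ : ∀ F H → θ (F ⊛ H) ≃ (θ F ⊛ H) ⊕ (F ⊛ θ H)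
  θ-⊛ F H i n = begin
      fromℕ n * sumTo i (λ a → sumTo n (λ b → F a b * H (i ∸ a) (n ∸ b)))
    ≡⟨ trans (sym (sumTo-* i (fromℕ n) (λ a → sumTo n (t a)))) (sumTo-cong i (λ a _ → trans (sym (sumTo-* n (fromℕ n) (t a)))
         (trans (sumTo-cong n (λ b b≤n → leibniz a b b≤n)) (sumTo-+ n (t₁ a) (t₂ a))))) ⟩
      sumTo i (λ a → sumTo n (t₁ a) + sumTo n (t₂ a))
    ≡⟨ sumTo-+ i (λ a → sumTo n (t₁ a)) (λ a → sumTo n (t₂ a)) ⟩
      (θ F ⊛ H) i n + (F ⊛ θ H) i n ∎
    where
    open ≡-Reasoning
    t t₁ t₂ : ℕ → ℕ → ℚ
    t  a b = F a b * H (i ∸ a) (n ∸ b)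
    t₁ a b = θ F a b * H (i ∸ a) (n ∸ b)
    t₂ a b = F a b * θ H (i ∸ a) (n ∸ b)
    leibniz : ∀ a b → b ≤ n → fromℕ n * (F a b * H (i ∸ a) (n ∸ b)) ≡
              (fromℕ b * F a b) * H (i ∸ a) (n ∸ b) + F a b * (fromℕ (n ∸ b) * H (i ∸ a) (n ∸ b))
    leibniz a b b≤n = trans
      (cong (_* (F a b * H (i ∸ a) (n ∸ b))) (trans (cong fromℕ (sym (ℕ.m+[n∸m]≡n b≤n))) (fromℕ-+ b (n ∸ b))))
      (solve 4 (λ p q x y → (p :+ q) :* (x :* y) := (p :* x) :* y :+ x :* (q :* y)) refl
         (fromℕ b) (fromℕ (n ∸ b)) (F a b) (H (i ∸ a) (n ∸ b)))

  0S : FPS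
  0S _ _ = 0ℚ

  θ-constant : ∀ {F} → (∀ i n → F i (suc n) ≡ 0ℚ) → θ F ≃ 0S
  θ-constant {F} e i zero    = *-zeroˡ (F i 0)
  θ-constant {F} e i (suc n) = trans (cong (fromℕ (suc n) *_) (e i n)) (*-zeroʳ (fromℕ (suc n)))

  θ-1S : θ 1S ≃ 0S
  θ-1S = θ-constant (λ { zero n → refl ; (suc i) n → refl })

  scale-⊛ : ∀ c F H → scale c F ⊛ H ≃ scale c (F ⊛ H)
  scale-⊛ c F H i n = trans
      (sumTo-cong i (λ a _ → trans (sumTo-cong n (λ b _ → *-assoc c (F a b) (H (i ∸ a) (n ∸ b)))) (sumTo-* n c (t a))))
      (sumTo-* i c (λ a → sumTo n (t a)))
    where
    t : ℕ → ℕ → ℚ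
    t a b = F a b * H (i ∸ a) (n ∸ b)

  ⊛-scale : ∀ c F H → F ⊛ scale c H ≃ scale c (F ⊛ H)
  ⊛-scale c F H = FS.trans (FS.*-comm F (scale c H)) (FS.trans (scale-⊛ c H F) (λ i n → cong (c *_) (FS.*-comm H F i n)))

  ⊖-⊕ : ∀ F H → (F ⊖ H) ⊕ H ≃ F
  ⊖-⊕ F H i n = trans (+-assoc (F i n) (- H i n) (H i n)) (trans (cong (F i n +_) (+-inverseˡ (H i n))) (+-identityʳ _))

  ⊕-cancelʳ : ∀ J {F H} → F ⊕ J ≃ H ⊕ J → F ≃ H
  ⊕-cancelʳ J e i n = +-cancelʳ (J i n) _ _ (e i n)
    where
    open import Algebra.Properties.Group +-0-group using () renaming (∙-cancelʳ to +-cancelʳ)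

  θ-power : ∀ w k → θ (powS w (suc k)) ≃ scale (fromℕ (suc k)) (powS w k ⊛ θ w)
  θ-power w zero = FS.trans (θ-⊛ w 1S) (FS.trans (FS.+-congˡ {θ w ⊛ 1S} (FS.trans (FS.*-congˡ {w} θ-1S) (FS.zeroʳ w)))
    (FS.trans (FS.+-identityʳ (θ w ⊛ 1S)) (FS.trans (FS.*-comm (θ w) 1S) (λ i n → sym (*-identityˡ _)))))
  θ-power w (suc k) = FS.trans (θ-⊛ w (powS w (suc k))) (FS.trans (FS.+-cong (FS.*-comm (θ w) (powS w (suc k)))
      (FS.trans (FS.*-congˡ {w} (θ-power w k)) (FS.trans (⊛-scale (fromℕ (suc k)) w (powS w k ⊛ θ w))
        (λ i n → cong (fromℕ (suc k) *_) (FS.sym (FS.*-assoc w (powS w k) (θ w)) i n)))))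
    (λ i n → trans (solve 2 (λ x c → x :+ c :* x := (con 1 :+ c) :* x) refl ((powS w (suc k) ⊛ θ w) i n) (fromℕ (suc k)))
                   (cong (_* (powS w (suc k) ⊛ θ w) i n) (sym (fromℕ-+ 1 (suc k))))))

  Order : ℕ → FPS → Set
  Order k F = ∀ i n → i ℕ.+ n < k → F i n ≡ 0ℚ

  -- The one term that evaluates H at full degree carries the factor `w 0 0`; in all others H is
  -- evaluated below degree k.
  ⊛-order : ∀ {w H k} → w 0 0 ≡ 0ℚ → Order k H → Order (suc k) (w ⊛ H)
  ⊛-order {w} {H} {k} w₀ low i n i+n<1+k = trans
      (sumTo-cong i (λ a a≤i → trans (sumTo-cong n (λ b b≤n → term a b a≤i b≤n)) (sumTo-0 n))) (sumTo-0 i)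
    where
    later : ∀ a b → (i ∸ a) ℕ.+ (n ∸ b) < i ℕ.+ n → w a b * H (i ∸ a) (n ∸ b) ≡ 0ℚ
    later a b lt = trans (cong (w a b *_) (low (i ∸ a) (n ∸ b) (ℕ.<-≤-trans lt (ℕ.≤-pred i+n<1+k)))) (*-zeroʳ (w a b))
    ∸-suc-< : ∀ {m k} → suc k ≤ m → m ∸ suc k < m
    ∸-suc-< {suc m} {k} _ = s≤s (ℕ.m∸n≤m m k)
    term : ∀ a b → a ≤ i → b ≤ n → w a b * H (i ∸ a) (n ∸ b) ≡ 0ℚ
    term zero    zero    _   _   = trans (cong (_* H i n) w₀) (*-zeroˡ (H i n))
    term zero    (suc b) _   b≤n = later 0 (suc b) (ℕ.+-monoʳ-< i (∸-suc-< b≤n))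
    term (suc a) b       a≤i _   = later (suc a) b (ℕ.+-mono-<-≤ (∸-suc-< a≤i) (ℕ.m∸n≤m n b))

  -- Coefficients of w f(w) and of the derivative of f.
  shiftCoeffs derivCoeffs : (ℕ → ℚ) → ℕ → ℚ
  shiftCoeffs f zero    = 0ℚ
  shiftCoeffs f (suc k) = f k
  derivCoeffs f k = fromℕ (suc k) * f (suc k)

  compose-cong : ∀ {f g} w → (∀ k → f k ≡ g k) → compose f w ≃ compose g w
  compose-cong w e i n = sumTo-cong (i ℕ.+ n) (λ k _ → cong (_* powS w k i n) (e k))

  compose-+ : ∀ f g w → compose (λ k → f k + g k) w ≃ compose f w ⊕ compose g w
  compose-+ f g w i n = trans (sumTo-cong (i ℕ.+ n) (λ k _ → *-distribʳ-+ (powS w k i n) (f k) (g k))) (sumTo-+ (i ℕ.+ n) (λ k → f k * powS w k i n) (λ k → g k * powS w k i n))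

  compose-scale : ∀ c f w → compose (λ k → c * f k) w ≃ scale c (compose f w)
  compose-scale c f w i n = trans (sumTo-cong (i ℕ.+ n) (λ k _ → *-assoc c (f k) (powS w k i n))) (sumTo-* (i ℕ.+ n) c (λ k → f k * powS w k i n))

  compose-unit : ∀ w → compose Z.unit w ≃ 1S
  compose-unit w i n = constant (i ℕ.+ n)
    where
    constant : ∀ N → sumTo N (λ k → Z.unit k * powS w k i n) ≡ 1S i n
    constant zero    = *-identityˡ (1S i n)
    constant (suc N) = trans (cong₂ _+_ (constant N) (*-zeroˡ (powS w (suc N) i n))) (+-identityʳ _)

  module Substitution {w : FPS} (w₀ : w 0 0 ≡ 0ℚ) where

    power-order : ∀ k → Order k (powS w k)
    power-order zero    i n ()
    power-order (suc k) = ⊛-order {w} {powS w k} w₀ (power-order k)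

    -- `compose` truncates at a bound depending on the coefficient. A common larger bound lets sums
    -- over k be exchanged with the convolution.
    compose-extend : ∀ f N i n → i ℕ.+ n ≤ N → compose f w i n ≡ sumTo N (λ k → f k * powS w k i n)
    compose-extend f N i n ≤N = sumTo-extend (i ℕ.+ n) N _ ≤N
      (λ k lt → trans (cong (f k *_) (power-order k i n lt)) (*-zeroʳ (f k)))

    compose-⊛ : ∀ f H i n → (compose f w ⊛ H) i n ≡ sumTo (i ℕ.+ n) (λ k → f k * (powS w k ⊛ H) i n)
    compose-⊛ f H i n = begin
        sumTo i (λ a → sumTo n (λ b → compose f w a b * h a b))
      ≡⟨ sumTo-cong i (λ a a≤i → trans
           (sumTo-cong n (λ b b≤n → trans (cong (_* h a b) (compose-extend f N a b (ℕ.+-mono-≤ a≤i b≤n))) (expand a b)))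
           (trans (sumTo-comm n N (λ b k → f k * (powS w k a b * h a b))) (sumTo-cong N (λ k _ → sumTo-* n (f k) (λ b → powS w k a b * h a b))))) ⟩
        sumTo i (λ a → sumTo N (λ k → f k * sumTo n (λ b → powS w k a b * h a b)))
      ≡⟨ trans (sumTo-comm i N (λ a k → f k * sumTo n (λ b → powS w k a b * h a b))) (sumTo-cong N (λ k _ → sumTo-* i (f k) (λ a → sumTo n (λ b → powS w k a b * h a b)))) ⟩
        sumTo N (λ k → f k * (powS w k ⊛ H) i n) ∎
      where
      open ≡-Reasoning
      N = i ℕ.+ n
      h : ℕ → ℕ → ℚ
      h a b = H (i ∸ a) (n ∸ b)
      expand : ∀ a b → sumTo N (λ k → f k * powS w k a b) * h a b ≡ sumTo N (λ k → f k * (powS w k a b * h a b))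
      expand a b = trans (*-comm (sumTo N (λ k → f k * powS w k a b)) (h a b)) (trans (sym (sumTo-* N (h a b) (λ k → f k * powS w k a b)))
        (sumTo-cong N (λ k _ → solve 3 (λ x y z → x :* (y :* z) := y :* (z :* x)) refl (h a b) (f k) (powS w k a b))))

    θ-compose : ∀ f → θ (compose f w) ≃ compose (derivCoeffs f) w ⊛ θ w
    θ-compose f i n = begin
        fromℕ n * compose f w i n
      -- One extra term, because differentiation lowers the index k by one.
      ≡⟨ cong (fromℕ n *_) (compose-extend f (suc N) i n (ℕ.n≤1+n N)) ⟩
        fromℕ n * sumTo (suc N) (λ k → f k * powS w k i n)
      ≡⟨ trans (sym (sumTo-* (suc N) (fromℕ n) (λ k → f k * powS w k i n))) (sumTo-cong (suc N) (λ k _ →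
           solve 3 (λ x y z → x :* (y :* z) := y :* (x :* z)) refl (fromℕ n) (f k) (powS w k i n))) ⟩
        sumTo (suc N) (λ k → f k * θ (powS w k) i n)
      ≡⟨ sumTo-suc N (λ k → f k * θ (powS w k) i n) ⟩
        f 0 * θ 1S i n + sumTo N (λ k → f (suc k) * θ (powS w (suc k)) i n)
      ≡⟨ cong₂ _+_ (trans (cong (f 0 *_) (θ-1S i n)) (*-zeroʳ (f 0))) (sumTo-cong N (λ k _ →
           trans (cong (f (suc k) *_) (θ-power w k i n))
                 (solve 3 (λ x y z → x :* (y :* z) := y :* x :* z) refl (f (suc k)) (fromℕ (suc k)) ((powS w k ⊛ θ w) i n)))) ⟩
        0ℚ + sumTo N (λ k → derivCoeffs f k * (powS w k ⊛ θ w) i n)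
      ≡⟨ trans (+-identityˡ _) (sym (compose-⊛ (derivCoeffs f) (θ w) i n)) ⟩
        (compose (derivCoeffs f) w ⊛ θ w) i n ∎
      where
      open ≡-Reasoning
      N = i ℕ.+ n

    compose-shift : ∀ f → compose f w ⊛ w ≃ compose (shiftCoeffs f) w
    compose-shift f i n = begin
        (compose f w ⊛ w) i n
      ≡⟨ compose-⊛ f w i n ⟩
        sumTo N (λ k → f k * (powS w k ⊛ w) i n)
      ≡⟨ sumTo-cong N (λ k _ → cong (f k *_) (FS.*-comm (powS w k) w i n)) ⟩
        sumTo N (λ k → f k * powS w (suc k) i n)
      ≡⟨ sym (trans (cong (_+ sumTo N (λ k → f k * powS w (suc k) i n)) (*-zeroˡ (1S i n))) (+-identityˡ _)) ⟩
        0ℚ * 1S i n + sumTo N (λ k → f k * powS w (suc k) i n)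
      ≡⟨ sym (sumTo-suc N (λ k → shiftCoeffs f k * powS w k i n)) ⟩
        sumTo (suc N) (λ k → shiftCoeffs f k * powS w k i n)
      ≡⟨ sym (compose-extend (shiftCoeffs f) (suc N) i n (ℕ.n≤1+n N)) ⟩
        compose (shiftCoeffs f) w i n ∎
      where
      open ≡-Reasoning
      N = i ℕ.+ n

    compose-1+w : ∀ f g → (∀ k → f k + shiftCoeffs f k ≡ g k) → compose f w ⊕ (compose f w ⊛ w) ≃ compose g w
    compose-1+w f g e = FS.trans (FS.+-congˡ {compose f w} (compose-shift f))
      (FS.trans (FS.sym (compose-+ f (shiftCoeffs f) w)) (compose-cong w e))

    -- After w E is added to both sides the claim reads E = 1 + w E, an identity between coefficient
    -- sequences in powers of w.
    geometric : (1S ⊖ w) ⊛ compose geomC w ≃ 1S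
    geometric = ⊕-cancelʳ (w ⊛ E) (FS.trans (FS.sym (FS.distribʳ E (1S ⊖ w) w)) (FS.trans (FS.*-congʳ {E} (⊖-⊕ 1S w))
      (FS.trans (FS.*-identityˡ E) (FS.sym (FS.trans (FS.+-cong (FS.sym (compose-unit w)) (FS.trans (FS.*-comm w E) (compose-shift geomC)))
        (FS.trans (FS.sym (compose-+ Z.unit (shiftCoeffs geomC) w)) (compose-cong {λ k → Z.unit k + shiftCoeffs geomC k} {geomC} w (λ { zero → refl ; (suc k) → refl }))))))))
      where
      E = compose geomC w

  ⊛-z⁰ : ∀ {F} → (∀ i → F i 0 ≡ 0ℚ) → ∀ H i → (F ⊛ H) i 0 ≡ 0ℚ
  ⊛-z⁰ e H i = trans (sumTo-cong i (λ a _ → trans (cong (_* H (i ∸ a) 0) (e a)) (*-zeroˡ (H (i ∸ a) 0)))) (sumTo-0 i)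

  compose-z⁰ : ∀ f w → (∀ i → w i 0 ≡ 0ℚ) → ∀ i → compose f w i 0 ≡ f 0 * 1S i 0
  compose-z⁰ f w e i = lower (i ℕ.+ 0)
    where
    lower : ∀ N → sumTo N (λ k → f k * powS w k i 0) ≡ f 0 * 1S i 0
    lower zero    = refl
    lower (suc N) = trans (cong₂ _+_ (lower N) (trans (cong (f (suc N) *_) (⊛-z⁰ {w} e (powS w N) i)) (*-zeroʳ (f (suc N))))) (+-identityʳ _)

  private
    -- The sign in log1pC is a local function of Defs, which also takes the argument of the
    -- enclosing clause and has no name here; unification recovers it. Abstracting over _*_ and
    -- -_ lets the two sides be unified argument by argument.
    log1pC-sign : ∀ k → Σ ℚ λ s → log1pC (suc (suc k)) ≡ (- s) * (ℤ.+ 1 / suc (suc k))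
    log1pC-sign k with _*_ | -_
    ... | _ | _ = _ , refl

    mutual
      sign : ℕ → ℕ → ℚ
      sign = _

      log1pC-sign≡ : ∀ k → proj₁ (log1pC-sign k) ≡ sign (suc k) k
      log1pC-sign≡ k with suc k
      ... | _ = refl

  -- The first argument comes from the clause enclosing the local sign function, and consecutive
  -- coefficients carry different values of it.
  sign-irrelevant : ∀ m m′ k → sign m k ≡ sign m′ k
  sign-irrelevant m m′ zero    = refl
  sign-irrelevant m m′ (suc k) = cong -_ (sign-irrelevant m m′ k)

  -- The equation (1 + w) f′ = 1 for f = ln(1 + w): the derivative has coefficients of alternating
  -- sign, and neighbours cancel.
  deriv-log : ∀ k → derivCoeffs log1pC k + shiftCoeffs (derivCoeffs log1pC) k ≡ Z.unit k
  deriv-log zero    = refl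
  deriv-log (suc k) = trans
    (cong₂ _+_ (reciprocal (sign (suc k) (suc k)) (2 ℕ.+ k)) (reciprocal (sign k k) (suc k)))
    (trans (cong (λ s → - s + sign k k) (sign-irrelevant (suc k) k k)) (+-inverseˡ (sign k k)))
    where
    reciprocal : ∀ s m .{{_ : NonZero m}} → fromℕ m * (s * (ℤ.+ 1 / m)) ≡ s
    reciprocal s m = trans (solve 3 (λ x y z → x :* (y :* z) := y :* (x :* z)) refl (fromℕ m) s (ℤ.+ 1 / m))
      (trans (cong (s *_) (/-cancel 1 m)) (*-identityʳ s))

  deriv-binom : ∀ α k → derivCoeffs (binomC α) k ≡ binomC α k * (α - fromℕ k)
  deriv-binom α k = trans
      (solve 4 (λ m f d x → m :* (f :* d :* x) := f :* (m :* x) :* d) refl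
         (fromℕ (suc k)) (fallingQ α k) (α - fromℕ k) ((ℤ.+ 1 / (suc k !)) {{suc k !≢0}}))
      (cong (λ x → fallingQ α k * x * (α - fromℕ k)) ratio)
    where
    r = (ℤ.+ 1 / (suc k !)) {{suc k !≢0}}
    ratio : fromℕ (suc k) * r ≡ (ℤ.+ 1 / (k !)) {{k !≢0}}
    ratio = *-cancelˡ-fromℕ (k !) {{k !≢0}} (trans
      (trans (sym (*-assoc (fromℕ (k !)) (fromℕ (suc k)) r))
        (trans (cong (_* r) (trans (*-comm (fromℕ (k !)) (fromℕ (suc k))) (sym (fromℕ-* (suc k) (k !)))))
               (/-cancel 1 (suc k !) {{suc k !≢0}})))
      (sym (/-cancel 1 (k !) {{k !≢0}})))

  -- The equation (1 + w) f′ = α f for f = (1 + w)^α: the factors α - k and k of the same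
  -- coefficient add up to α.
  binom-ode : ∀ α k → derivCoeffs (binomC α) k + shiftCoeffs (derivCoeffs (binomC α)) k ≡ α * binomC α k
  binom-ode α zero    = trans (+-identityʳ _) (trans (deriv-binom α 0)
    (trans (*-comm (binomC α 0) (α - fromℕ 0)) (cong (_* binomC α 0) (+-identityʳ α))))
  binom-ode α (suc k) = trans (cong (_+ fromℕ (suc k) * b) (deriv-binom α (suc k))) (trans
    (solve 4 (λ b α -m m → b :* (α :+ -m) :+ m :* b := α :* b :+ (-m :+ m) :* b) refl b α (- fromℕ (suc k)) (fromℕ (suc k)))
    (trans (cong (α * b +_) (trans (cong (_* b) (+-inverseˡ (fromℕ (suc k)))) (*-zeroˡ b))) (+-identityʳ _)))
    where
    b = binomC α (suc k)

-- The equations of the closed form, compared coefficient by coefficient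

module Coefficients where
  open Recurrence using (M; Total; Adjacent; Total-suc; Adjacent-suc; Total-bound; shift; double; double≡+)
  open Enumeration using (G≡Total)
  open Semirings
  open Series
  open import Data.Bool using (true; false; if_then_else_; T)
  open import Data.Nat as ℕ using (zero; suc; s≤s; _!; _<ᵇ_)
  import Data.Nat.Properties as ℕ
  open import Data.Nat.Properties using (_!≢0)
  import Data.Integer as ℤ
  open import Data.Rational using (ℚ; 0ℚ; 1ℚ; _+_; _*_; _/_)
  open import Data.Rational.Properties
  open import Relation.Binary.PropositionalEquality

  t : FPS
  t = scale (ℤ.+ 2 / 1) zS

  -t : FPS
  -t = scale (ℤ.-[1+ 1 ] / 1) zS

  -- Spelled so that `rhsS` is `E ⊛ (B ⊛ L)` by definition.
  Q W B L E : FPS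
  Q = constS 1ℚ ⊖ (zS ⊛ (constS 1ℚ ⊕ yS))
  W = (Q ⊛ compose geomC t) ⊖ constS 1ℚ
  B = compose (binomC (ℤ.-[1+ 0 ] / 2)) -t
  L = compose log1pC W
  E = compose geomC yS

  zS-⊛-zero : ∀ F i → (zS ⊛ F) i 0 ≡ 0ℚ
  zS-⊛-zero F i = trans (⊛-✶ zS F i 0) (trans (YZ.✶-constant (λ i n → *-zeroˡ (δ n 1)) F i 0) (*-zeroˡ (F i 0)))

  zS-⊛-suc : ∀ F i n → (zS ⊛ F) i (suc n) ≡ F i n
  zS-⊛-suc F i n = trans (⊛-✶ zS F i (suc n)) (trans (YZ.✶-constant (λ i n → *-zeroˡ (δ n 1)) F i (suc n))
    (Z.✶-variable {f = zS 0} refl (λ { zero → refl ; (suc n) → refl }) (F i) n))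

  yS-⊛-zero : ∀ F n → (yS ⊛ F) 0 n ≡ 0ℚ
  yS-⊛-zero F n = trans (⊛-✶ yS F 0 n) (trans (Z.✶-cong (λ n → *-zeroˡ (δ n 0)) (λ _ → refl) n) (Z.✶-zeroˡ (F 0) n))

  yS-⊛-suc : ∀ F i n → (yS ⊛ F) (suc i) n ≡ F i n
  yS-⊛-suc F i n = trans (⊛-✶ yS F (suc i) n) (YZ.✶-variable {f = yS} (λ n → *-zeroˡ (δ n 0)) (λ { zero zero → refl ; zero (suc n) → refl ; (suc i) n → *-zeroˡ (δ n 0) }) F i n)

  t≃ : t ≃ zS ⊕ zS
  t≃ i n = trans (*-distribʳ-+ (zS i n) 1ℚ 1ℚ) (cong₂ _+_ (*-identityˡ (zS i n)) (*-identityˡ (zS i n)))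

  θ-zS : θ zS ≃ zS
  θ-zS zero    zero          = refl
  θ-zS zero    (suc zero)    = refl
  θ-zS zero    (suc (suc n)) = *-zeroʳ (fromℕ (2 ℕ.+ n))
  θ-zS (suc i) zero          = refl
  θ-zS (suc i) (suc zero)    = refl
  θ-zS (suc i) (suc (suc n)) = *-zeroʳ (fromℕ (2 ℕ.+ n))

  θ-scale : ∀ c F → θ (scale c F) ≃ scale c (θ F)
  θ-scale c F i n = trans (sym (*-assoc (fromℕ n) c (F i n))) (trans (cong (_* F i n) (*-comm (fromℕ n) c)) (*-assoc c (fromℕ n) (F i n)))

  u v : FPS
  u = 1S ⊖ t
  v = 1S ⊖ yS

  θ-scale-zS : ∀ c → θ (scale c zS) ≃ scale c zS
  θ-scale-zS c = FS.trans (θ-scale c zS) (λ i n → cong (c *_) (θ-zS i n))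

  θu+t : θ u ⊕ t ≃ 0S
  θu+t = FS.trans (FS.+-congˡ {θ u} (FS.sym (θ-scale-zS (ℤ.+ 2 / 1)))) (FS.trans (FS.sym (θ-⊕ u t)) (FS.trans (θ-cong (⊖-⊕ 1S t)) θ-1S))

  module Eqs = Elimination.Logarithm fps-semiring ⊕-cancelʳ {zS} {yS} {t} {u} {v} {Q} {W} {compose geomC t}
    (⊖-⊕ 1S t) (⊖-⊕ 1S yS) t≃ (⊖-⊕ 1S (zS ⊛ (1S ⊕ yS))) (⊖-⊕ (Q ⊛ compose geomC t) 1S) (Substitution.geometric {t} refl)

  tS-⊛-zero : ∀ F i → (t ⊛ F) i 0 ≡ 0ℚ
  tS-⊛-zero F i = trans (scale-⊛ (ℤ.+ 2 / 1) zS F i 0) (trans (cong ((ℤ.+ 2 / 1) *_) (zS-⊛-zero F i)) refl)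

  -- W = t W + u W = t W + z v, and both summands are multiples of z. The whole row is required for
  -- the right-hand side to vanish at z = 0.
  W⁰ : ∀ i → W i 0 ≡ 0ℚ
  W⁰ i = trans (Eqs.u-absorb W i 0) (cong₂ _+_ (tS-⊛-zero W i) (trans (Eqs.uW i 0) (zS-⊛-zero v i)))

  θ-v : θ v ≃ 0S
  θ-v = θ-constant {v} (λ { zero n → refl ; (suc zero) n → refl ; (suc (suc i)) n → refl })

  θ-uW : (θ u ⊛ W) ⊕ (u ⊛ θ W) ≃ zS ⊛ v
  θ-uW = FS.trans (FS.sym (θ-⊛ u W)) (FS.trans (θ-cong Eqs.uW) (FS.trans (θ-⊛ zS v)
    (FS.trans (FS.+-cong (FS.*-congʳ {v} θ-zS) (FS.trans (FS.*-congˡ {zS} θ-v) (FS.zeroʳ zS))) (FS.+-identityʳ (zS ⊛ v)))))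

  θ-L : θ L ⊕ (θ L ⊛ W) ≃ θ W
  θ-L = begin
      θ L ⊕ (θ L ⊛ W)                         ≈⟨ FS.+-cong (θ-compose log1pC) (FS.*-congʳ {W} (θ-compose log1pC)) ⟩
      (D ⊛ θ W) ⊕ ((D ⊛ θ W) ⊛ W)             ≈⟨ solve 3 (λ d w x → d :* x :+ d :* x :* w := (d :+ d :* w) :* x) FS.refl D W (θ W) ⟩
      (D ⊕ (D ⊛ W)) ⊛ θ W                     ≈⟨ FS.*-congʳ {θ W} (FS.trans (compose-1+w (derivCoeffs log1pC) Z.unit deriv-log) (compose-unit W)) ⟩
      1S ⊛ θ W                                ≈⟨ FS.*-identityˡ (θ W) ⟩
      θ W                                     ∎
    where
    open Substitution {W} (W⁰ 0)
    open import Relation.Binary.Reasoning.Setoid FS.setoid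
    open import Algebra.Solver.Ring.NaturalCoefficients.Default fps-semiring using (solve; _:+_; _:*_; _:=_)
    D = compose (derivCoeffs log1pC) W

  u-B : u ⊛ θ B ≃ zS ⊛ B
  u-B = begin
      u ⊛ θ B                              ≈⟨ FS.*-cong u≃ (FS.trans (θ-compose b) (FS.*-congˡ {D} (θ-scale-zS (ℤ.-[1+ 1 ] / 1)))) ⟩
      (1S ⊕ -t) ⊛ (D ⊛ -t)                 ≈⟨ FS.distribʳ (D ⊛ -t) 1S -t ⟩
      (1S ⊛ (D ⊛ -t)) ⊕ (-t ⊛ (D ⊛ -t))    ≈⟨ FS.+-congʳ { -t ⊛ (D ⊛ -t)} (FS.*-identityˡ (D ⊛ -t)) ⟩
      (D ⊛ -t) ⊕ (-t ⊛ (D ⊛ -t))           ≈⟨ solve 2 (λ d w → d :* w :+ w :* (d :* w) := w :* (d :+ d :* w)) FS.refl D -t ⟩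
      -t ⊛ (D ⊕ (D ⊛ -t))                  ≈⟨ FS.*-congˡ { -t} (FS.trans (compose-1+w (derivCoeffs b) (λ k → α * b k) (binom-ode α)) (compose-scale α b -t)) ⟩
      -t ⊛ scale α B                       ≈⟨ FS.trans (⊛-scale α -t B) (FS.sym (scale-⊛ α -t B)) ⟩
      -- The scalars multiply to (-1/2) (-2) = 1 by evaluation.
      scale α -t ⊛ B                       ≈⟨ FS.*-congʳ {B} (λ i n → trans (sym (*-assoc α (ℤ.-[1+ 1 ] / 1) (zS i n))) (*-identityˡ (zS i n))) ⟩
      zS ⊛ B                               ∎
    where
    α = ℤ.-[1+ 0 ] / 2
    b = binomC α
    open Substitution { -t} refl
    open import Relation.Binary.Reasoning.Setoid FS.setoid
    open import Algebra.Solver.Ring.NaturalCoefficients.Default fps-semiring using (solve; _:+_; _:*_; _:=_)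
    D = compose (derivCoeffs b) -t
    u≃ : u ≃ 1S ⊕ -t
    u≃ i n = cong (1S i n +_) (neg-distribˡ-* (ℤ.+ 2 / 1) (zS i n))

  C : FPS
  C = E ⊛ (B ⊛ (u ⊛ θ L))

  C-equation : C ≃ (zS ⊛ B) ⊕ ((zS ⊛ (1S ⊕ yS)) ⊛ C)
  C-equation = Eqs.correction-equation {θ W} {θ u} θ-uW θu+t {θ L} θ-L {E} {B} {θ B} {L} (Substitution.geometric {yS} refl) u-B

  θ-E : θ E ≃ 0S
  θ-E = FS.trans (Substitution.θ-compose {yS} refl geomC) (FS.trans (FS.*-congˡ {compose (derivCoeffs geomC) yS}
    (θ-constant {yS} (λ { zero n → refl ; (suc zero) n → refl ; (suc (suc i)) n → refl })))
    (FS.zeroʳ (compose (derivCoeffs geomC) yS)))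

  rhs-equation : θ rhsS ≃ (t ⊛ θ rhsS) ⊕ ((zS ⊛ rhsS) ⊕ C)
  rhs-equation = Eqs.product-equation {θ W} {θ u} θ-uW θu+t {θ L} θ-L {E} {B} {θ B} {L} (Substitution.geometric {yS} refl) u-B {θ rhsS}
    (FS.trans (θ-⊛ E (B ⊛ L)) (FS.trans (FS.+-congʳ {E ⊛ θ (B ⊛ L)} (FS.trans (FS.*-congʳ {B ⊛ L} θ-E) (FS.zeroˡ (B ⊛ L))))
      (FS.trans (FS.+-identityˡ (E ⊛ θ (B ⊛ L))) (FS.*-congˡ {E} (θ-⊛ B L)))))

  B-equation : θ B ≃ (t ⊛ θ B) ⊕ (zS ⊛ B)
  B-equation = FS.trans (Eqs.u-absorb (θ B)) (FS.+-congˡ {t ⊛ θ B} u-B)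

  t-⊛-θ-suc : ∀ F i n → (t ⊛ θ F) i (suc n) ≡ fromℕ (n ℕ.+ n) * F i n
  t-⊛-θ-suc F i n = trans (FS.*-congʳ {θ F} t≃ i (suc n)) (trans (FS.distribʳ (θ F) zS zS i (suc n))
    (trans (cong₂ _+_ (zS-⊛-suc (θ F) i n) (zS-⊛-suc (θ F) i n))
      (trans (sym (*-distribʳ-+ (F i n) (fromℕ n) (fromℕ n))) (cong (_* F i n) (sym (fromℕ-+ n n))))))

  -- The rational counterpart of `shift true`: multiplication by y.
  previous : ℕ → (ℕ → ℚ) → ℚ
  previous zero    f = 0ℚ
  previous (suc p) f = f p

  yS-⊛ : ∀ F p n → (yS ⊛ F) p n ≡ previous p (λ q → F q n)
  yS-⊛ F zero    n = yS-⊛-zero F n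
  yS-⊛ F (suc p) n = yS-⊛-suc F p n

  B-suc : ∀ p n → fromℕ (suc n) * B p (suc n) ≡ fromℕ (suc (n ℕ.+ n)) * B p n
  B-suc p n = trans (B-equation p (suc n)) (trans (cong₂ _+_ (t-⊛-θ-suc B p n) (zS-⊛-suc B p n))
    (trans (solve 2 (λ m b → m :* b :+ b := (con 1 :+ m) :* b) refl (fromℕ (n ℕ.+ n)) (B p n))
           (cong (_* B p n) (sym (fromℕ-+ 1 (n ℕ.+ n))))))
    where open import Algebra.Solver.Ring.NaturalCoefficients.Default ℚ-semiring using (solve; _:+_; _:*_; _:=_; con)

  zy-expand : ∀ F → (zS ⊛ (1S ⊕ yS)) ⊛ F ≃ zS ⊛ (F ⊕ (yS ⊛ F))
  zy-expand F = FS.trans (FS.*-assoc zS (1S ⊕ yS) F) (FS.*-congˡ {zS} (FS.trans (FS.distribʳ F 1S yS) (FS.+-congʳ {yS ⊛ F} (FS.*-identityˡ F))))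

  C-zero : ∀ p → C p 0 ≡ 0ℚ
  C-zero p = trans (C-equation p 0) (cong₂ _+_ (zS-⊛-zero B p) (trans (zy-expand C p 0) (zS-⊛-zero (C ⊕ (yS ⊛ C)) p)))

  C-suc : ∀ p n → C p (suc n) ≡ B p n + (C p n + previous p (λ q → C q n))
  C-suc p n = trans (C-equation p (suc n)) (cong₂ _+_ (zS-⊛-suc B p n)
    (trans (zy-expand C p (suc n)) (trans (zS-⊛-suc (C ⊕ (yS ⊛ C)) p n) (cong (C p n +_) (yS-⊛ C p n)))))

  rhs-suc : ∀ p n → fromℕ (suc n) * rhsS p (suc n) ≡ fromℕ (suc (n ℕ.+ n)) * rhsS p n + C p (suc n)
  rhs-suc p n = trans (rhs-equation p (suc n)) (trans (cong₂ (λ a b → a + (b + C p (suc n))) (t-⊛-θ-suc rhsS p n) (zS-⊛-suc rhsS p n))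
    (trans (solve 3 (λ m b c → m :* b :+ (b :+ c) := (con 1 :+ m) :* b :+ c) refl (fromℕ (n ℕ.+ n)) (rhsS p n) (C p (suc n)))
           (cong (λ m → m * rhsS p n + C p (suc n)) (sym (fromℕ-+ 1 (n ℕ.+ n))))))
    where open import Algebra.Solver.Ring.NaturalCoefficients.Default ℚ-semiring using (solve; _:+_; _:*_; _:=_; con)

  rhs-zero : ∀ p → rhsS p 0 ≡ 0ℚ
  rhs-zero p = trans (FS.*-comm E (B ⊛ L) p 0) (⊛-z⁰ {B ⊛ L} (λ i → trans (FS.*-comm B L i 0) (⊛-z⁰ {L} L⁰ B i)) E p)
    where
    L⁰ : ∀ i → L i 0 ≡ 0ℚ
    L⁰ i = trans (compose-z⁰ log1pC W W⁰ i) (*-zeroˡ (1S i 0))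

  B-zero : ∀ p → fromℕ 1 * B p 0 ≡ fromℕ (M 0 0 0 0 p)
  B-zero p = trans (cong (fromℕ 1 *_) (compose-z⁰ (binomC (ℤ.-[1+ 0 ] / 2)) -t (λ { zero → refl ; (suc i) → refl }) p)) (base p)
    where
    base : ∀ p → fromℕ 1 * (binomC (ℤ.-[1+ 0 ] / 2) 0 * 1S p 0) ≡ fromℕ (M 0 0 0 0 p)
    base zero    = refl
    base (suc p) = refl

  fromℕ-! : ∀ n x → fromℕ (suc n !) * x ≡ fromℕ (n !) * (fromℕ (suc n) * x)
  fromℕ-! n x = trans (cong (_* x) (trans (fromℕ-* (suc n) (n !)) (*-comm (fromℕ (suc n)) (fromℕ (n !))))) (*-assoc (fromℕ (n !)) (fromℕ (suc n)) x)

  *-swap : ∀ x y z → x * (y * z) ≡ y * (x * z)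
  *-swap x y z = trans (sym (*-assoc x y z)) (trans (cong (_* z) (*-comm x y)) (*-assoc y x z))

  -- Both sides are (2n-1)!! at p = 0 and vanish for p > 0; each step multiplies them by 2 n + 1.
  B-count : ∀ n p → fromℕ (n !) * B p n ≡ fromℕ (M n 0 0 (double n) p)
  B-count zero    p = B-zero p
  B-count (suc n) p = begin
      fromℕ (suc n !) * B p (suc n)
    ≡⟨ trans (fromℕ-! n (B p (suc n))) (cong (fromℕ (n !) *_) (B-suc p n)) ⟩
      fromℕ (n !) * (fromℕ (suc (n ℕ.+ n)) * B p n)
    ≡⟨ *-swap (fromℕ (n !)) (fromℕ (suc (n ℕ.+ n))) (B p n) ⟩
      fromℕ (suc (n ℕ.+ n)) * (fromℕ (n !) * B p n)
    ≡⟨ cong₂ (λ m x → fromℕ (suc m) * x) (sym (double≡+ n)) (B-count n p) ⟩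
      fromℕ (suc (double n)) * fromℕ (M n 0 0 (double n) p)
    ≡⟨ sym (fromℕ-* (suc (double n)) (M n 0 0 (double n) p)) ⟩
      fromℕ (M (suc n) 0 0 (2 ℕ.+ double n) p) ∎
    where open ≡-Reasoning

  -- C is divisible by z, so its index runs one ahead of the factorial.
  C-count : ∀ n p → fromℕ (n !) * C p (suc n) ≡ fromℕ (Adjacent n p)
  C-count zero p = begin
      fromℕ 1 * C p 1
    ≡⟨ cong (fromℕ 1 *_) (trans (C-suc p 0) (trans (cong (B p 0 +_) (trans (cong₂ _+_ (C-zero p) (nothing p)) refl)) (+-identityʳ (B p 0)))) ⟩
      fromℕ 1 * B p 0
    ≡⟨ B-zero p ⟩
      fromℕ (Adjacent 0 p) ∎
    where
    open ≡-Reasoning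
    nothing : ∀ p → previous p (λ q → C q 0) ≡ 0ℚ
    nothing zero    = refl
    nothing (suc p) = C-zero p
  C-count (suc n) p = begin
      fromℕ (suc n !) * C p (2 ℕ.+ n)
    ≡⟨ trans (cong (fromℕ (suc n !) *_) (C-suc p (suc n))) (*-distribˡ-+ (fromℕ (suc n !)) (B p (suc n)) (C p (suc n) + C′)) ⟩
      fromℕ (suc n !) * B p (suc n) + fromℕ (suc n !) * (C p (suc n) + C′)
    ≡⟨ cong₂ _+_ (B-count (suc n) p) (trans (fromℕ-! n (C p (suc n) + C′)) (trans (*-swap (fromℕ (n !)) (fromℕ (suc n)) (C p (suc n) + C′))
         (cong (fromℕ (suc n) *_) (trans (*-distribˡ-+ (fromℕ (n !)) (C p (suc n)) C′)
           (trans (cong₂ _+_ (C-count n p) (shifted p)) (sym (fromℕ-+ (Adjacent n p) (shift true (Adjacent n) p)))))))) ⟩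
      fromℕ last + fromℕ (suc n) * fromℕ (Adjacent n p ℕ.+ shift true (Adjacent n) p)
    ≡⟨ trans (+-comm (fromℕ last) _) (trans (cong (_+ fromℕ last) (sym (fromℕ-* (suc n) (Adjacent n p ℕ.+ shift true (Adjacent n) p))))
         (sym (fromℕ-+ (suc n ℕ.* (Adjacent n p ℕ.+ shift true (Adjacent n) p)) last))) ⟩
      fromℕ (suc n ℕ.* (Adjacent n p ℕ.+ shift true (Adjacent n) p) ℕ.+ last)
    ≡⟨ cong fromℕ (sym (Adjacent-suc n p)) ⟩
      fromℕ (Adjacent (suc n) p) ∎
    where
    open ≡-Reasoning
    C′ = previous p (λ q → C q (suc n))
    last = M (suc n) 0 0 (2 ℕ.+ double n) p
    shifted : ∀ p → fromℕ (n !) * previous p (λ q → C q (suc n)) ≡ fromℕ (shift true (Adjacent n) p)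
    shifted zero    = *-zeroʳ (fromℕ (n !))
    shifted (suc p) = C-count n p

  rhs-count : ∀ n p → fromℕ (suc n !) * rhsS p (suc n) ≡ fromℕ (Total n p)
  rhs-count zero p = begin
      fromℕ 1 * rhsS p 1
    ≡⟨ rhs-suc p 0 ⟩
      fromℕ 1 * rhsS p 0 + C p 1
    ≡⟨ cong₂ _+_ (cong (fromℕ 1 *_) (rhs-zero p)) (sym (*-identityˡ (C p 1))) ⟩
      0ℚ + fromℕ 1 * C p 1
    ≡⟨ trans (+-identityˡ (fromℕ 1 * C p 1)) (C-count 0 p) ⟩
      fromℕ (Total 0 p) ∎
    where open ≡-Reasoning
  rhs-count (suc n) p = begin
      fromℕ (suc (suc n) !) * rhsS p (2 ℕ.+ n)
    ≡⟨ trans (fromℕ-! (suc n) (rhsS p (2 ℕ.+ n))) (cong (fromℕ (suc n !) *_) (rhs-suc p (suc n))) ⟩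
      fromℕ (suc n !) * (fromℕ m * rhsS p (suc n) + C p (2 ℕ.+ n))
    ≡⟨ *-distribˡ-+ (fromℕ (suc n !)) (fromℕ m * rhsS p (suc n)) (C p (2 ℕ.+ n)) ⟩
      fromℕ (suc n !) * (fromℕ m * rhsS p (suc n)) + fromℕ (suc n !) * C p (2 ℕ.+ n)
    ≡⟨ cong₂ _+_ (trans (*-swap (fromℕ (suc n !)) (fromℕ m) (rhsS p (suc n))) (cong (fromℕ m *_) (rhs-count n p))) (C-count (suc n) p) ⟩
      fromℕ m * fromℕ (Total n p) + fromℕ (Adjacent (suc n) p)
    ≡⟨ sym (trans (fromℕ-+ (m ℕ.* Total n p) (Adjacent (suc n) p)) (cong (_+ fromℕ (Adjacent (suc n) p)) (fromℕ-* m (Total n p)))) ⟩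
      fromℕ (m ℕ.* Total n p ℕ.+ Adjacent (suc n) p)
    ≡⟨ cong fromℕ (trans (cong (λ k → suc k ℕ.* Total n p ℕ.+ Adjacent (suc n) p) (sym (double≡+ (suc n)))) (sym (Total-suc n p))) ⟩
      fromℕ (Total (suc n) p) ∎
    where
    open ≡-Reasoning
    m = suc (suc n ℕ.+ suc n)

  lhs≡rhs : (p n : ℕ) → lhsS p n ≡ rhsS p n
  lhs≡rhs p zero    = sym (rhs-zero p)
  lhs≡rhs p (suc n) = *-cancelˡ-fromℕ (suc n !) {{suc n !≢0}} (trans (coefficient (p <ᵇ suc n) refl) (sym (rhs-count n p)))
    where
    -- The test is passed as a variable so that the conditional reduces. Where it fails, `Total` is
    -- zero by `Total-bound`.
    coefficient : ∀ b → (p <ᵇ suc n) ≡ b →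
                  fromℕ (suc n !) * (if b then (ℤ.+ G (suc n) p / (suc n !)) {{suc n !≢0}} else 0ℚ) ≡ fromℕ (Total n p)
    coefficient true  _ = trans (/-cancel (G (suc n) p) (suc n !) {{suc n !≢0}}) (cong fromℕ (G≡Total n p))
    coefficient false e = trans (*-zeroʳ (fromℕ (suc n !))) (cong fromℕ (sym (Total-bound n p (ℕ.≰⇒> (λ p≤n → subst T e (ℕ.<⇒<ᵇ (s≤s p≤n)))))))

theorem18 : (p n : ℕ) → lhsS p n ≡ rhsS p n
theorem18 = Coefficients.lhs≡rhs
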